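{- Let $\sigma$ be a switch table for permutations in $\mathrm{Sym}(n)$ (for a group of order $k$) with maximal effective row $r$ and $c_i$ non-trivial switches in row $i$ for $i=1,2,\dots,r$. Let $B_j=\{0,1\}^j$ be the set of all branch-selection vectors of length $j$. Then the typical number $E_{\mathrm{mst}}(m)$ of single-element evaluations of the modified switch-table method for two independently random $m$-subsets $S,S'$ of $[n]$ is $$E_{\mathrm{mst}}(m)=\Bigl(\sum_{b\in B_r}w_{1,m}(b)\,\nu_m(b)\Bigr)k+\sum_{j=1}^{r}\Bigl(\Bigl(\sum_{b\in B_j}w_{1,m}(b)\,\nu_m(b)\Bigr)\frac{c_j}{c_j+1}\cdot\frac{k}{\kappa_{j+1}}\Bigr).$$
   Context: Throughout $1\le m<n$, $[n]=\{1,\dots,n\}$. Switch tables. For a subgroup $G\le\mathrm{Sym}(n)$ of order $k$, a switch table is a map $(i,j)\mapsto\sigma_{i,j}\in G$ on $[n]\times[n]$ such that for $j>i$, if some $g\in G$ has $g(j)=i$ and $g(t)=t$ for all $t<i$, then $\sigma_{i,j}$ is one such $g$; otherwise $\sigma_{i,j}=\mathrm{id}$. Non-identity entries are non-trivial; a row is effective if it has a non-trivial entry; $r$ is the largest index of an effective row; $J(i)$ is the set of columns of non-trivial entries in row $i$ and $c_i=|J(i)|$. One has $k=\prod_{j=1}^r(c_j+1)$. Parameters. $\kappa_i:=\prod_{j=i}^{r}(c_j+1)$ (so $\kappa_1=k$, $\kappa_{r+1}=1$). For $0<\ell<n-i+1$: $\rho_i(\ell):=\frac{\ell}{n-i+1}$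 and $\bar\rho_i(\ell):=1-\rho_i(\ell)$; for $\ell\le0$ or $\ell\ge n-i+1$: $\rho_i(\ell):=\bar\rho_i(\ell):=0$. With $(x)_\ell:=x(x-1)\cdots(x-\ell+1)$, the transitivity gap is $\gamma_i(\ell):=\frac{(n-i+1-(c_i+1))_\ell}{(n-i+1)_\ell}$ for $0\le\ell\le n-i-c_i$ and $\gamma_i(\ell):=0$ for $\ell>n-i-c_i$. Reduction factors: $\alpha^{(1)}_i(\ell):=\rho_i(\ell)^2$ (element branch), $\alpha^{(0)}_i(\ell):=\bar\rho_i(\ell)\,\gamma_i(\ell)$ (non-element branch; equal to $0$ for $\ell\le 0$). For $b=(b_1,\dots,b_p)\in\{0,1\}^p$ let $|b|$ be its number of ones and $|b|_{<t}$ the number of ones among its first $t-1$ coordinates. Branch weight: $w_{i,\ell}(b):=\prod_{t=1}^{p}\alpha^{(b_t)}_{i+t-1}(\ell-|b|_{<t})$ (empty product $=1$). Node weight: $\nu_\ell(b):=\max(\ell-|b|,0)$. Modified switch-table method and cost. A call at level $i$ takes subsets $S,S'\subseteq\{i,\dots,n\}$ with $|S|=|S'|=\ell$; it is started at level $1$ with $\ell=m$. If $\ell=0$, or $i\le r$ and $\ell=n-i+1$, it returns at no cost. If $i=r+1$ and $\ell\ge1$, $S$ and $S'$ are compared lexicographically, counted as $\ell$ single-element evaluations. Otherwise: (element branch, $i\in S$) if $i\in S'$, make a call at level $i+1$ with $S\setminus\{i\},S'\setminus\{i\}$; and for each $j\in J(i)\cap S'$ compute $\sigma_{i,j}(S'\setminus\{j\})$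 ($\ell-1$ evaluations) and make a call at level $i+1$ with $S\setminus\{i\}$ and this image; (non-element branch, $i\notin S$) if $i\in S'$ or $J(i)\cap S'\ne\emptyset$, return at no cost; otherwise make a call at level $i+1$ with $S,S'$, and for each $j\in J(i)$ compute $\sigma_{i,j}(S')$ ($\ell$ evaluations) and make a call at level $i+1$ with $S$ and this image. For the analysis, a negative answer of a recursive call does not stop the algorithm; all branches are carried out. Typical number: the expected total number of evaluations in the paper's simplified ("hyper-amortized") uniform model, in which in every call at level $i$ with cardinality $\ell$ the two subsets are regarded as independent and uniformly random $\ell$-subsets of $\{i,\dots,n\}$, disregarding their dependence on the subsets of earlier calls. -}

module Defs where

open import Data.Bool.Base using (Bool; true; false; if_then_else_; _∨_)
open import Data.Fin.Base using (Fin; zero; suc; toℕ; fromℕ<)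
import Data.Fin.Base as Fin
import Data.Fin.Properties as Fin
open import Data.Fin.Permutation using (Permutation′; _≈_; _⟨$⟩ʳ_; _⟨$⟩ˡ_; _∘ₚ_)
import Data.Fin.Permutation as Perm
open import Data.Fin.Subset using (Subset; inside; outside; _∩_; _-_; ∣_∣)
open import Data.Fin.Subset.Properties using (_∈?_; _⊆?_; nonempty?)
open import Data.Integer.Base using (ℤ; +_; -[1+_])
import Data.Integer.Base as ℤ
open import Data.List.Base using (List; []; _∷_; _++_; map; filter; foldr; length; take; allFin; applyUpTo; cartesianProduct)
open import Data.List.Extrema.Nat using (max)
open import Data.Nat.Base using (ℕ; zero; suc; _+_; _∸_; _≡ᵇ_)
open import Data.Nat.ListAction using (product)
import Data.Nat.Properties as ℕ
open import Data.Nat.Combinatorics using (_P_)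
open import Data.Product.Base using (∃; _×_; _,_; proj₁)
open import Data.Rational.Base using (ℚ; 0ℚ; 1ℚ)
import Data.Rational.Base as ℚ
open import Data.Vec.Base using (Vec; []; _∷_; lookup; tabulate)
open import Function.Bundles using (Bijection)
open import Level using (Level)
open import Relation.Binary.Bundles using (Setoid)
import Relation.Binary.Construct.On as On
open import Relation.Binary.PropositionalEquality using (_≡_; _→-setoid_)
import Relation.Binary.PropositionalEquality.Properties as ≡
open import Relation.Nullary using (¬_; Dec; yes; no)
open import Relation.Nullary.Decidable using (⌊_⌋; ¬?; _×-dec_)
open import Relation.Unary using (Pred)

private
  variable
    a : Level
    A : Set a
    n p : ℕ

-- The element x of [n] = {1,…,n} is represented by the Fin n with value x - 1.
-- The index i of c, κ, ρ, γ, α and w is a 1-based natural number.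
label : Fin n → ℕ
label x = suc (toℕ x)

------------------------------------------------------------------------
-- Rational arithmetic

fromℕ : ℕ → ℚ
fromℕ x = + x ℚ./ 1

-- Total, with x ÷ 0 = 0; no denominator below vanishes where it matters.
infixl 7 _÷_
_÷_ : ℕ → ℕ → ℚ
x ÷ zero  = 0ℚ
x ÷ suc y = + x ℚ./ suc y

∑ : List A → (A → ℚ) → ℚ
∑ xs f = foldr ℚ._+_ 0ℚ (map f xs)

∏ : List A → (A → ℚ) → ℚ
∏ xs f = foldr ℚ._*_ 1ℚ (map f xs)

infix 6 ∑ ∏
syntax ∑ xs (λ x → e) = ∑[ x ∈ xs ] e
syntax ∏ xs (λ x → e) = ∏[ x ∈ xs ] e

-- Expectation of f under the uniform distribution on the entries of xs.
average : List A → (A → ℚ) → ℚ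
average xs f = (1 ÷ length xs) ℚ.* ∑ xs f

-- [ lo , lo + 1 , … , hi ], empty if hi < lo.
range : ℕ → ℕ → List ℕ
range lo hi = applyUpTo (λ x → lo + x) (suc hi ∸ lo)

------------------------------------------------------------------------
-- Subsets

-- Subset p is Vec Bool p, so this list is also {0,1}^p.
subsets : ∀ p → List (Subset p)
subsets zero    = [] ∷ []
subsets (suc p) = map (outside ∷_) (subsets p) ++ map (inside ∷_) (subsets p)

members : Subset n → List (Fin n)
members S = filter (_∈? S) (allFin _)

image : Permutation′ n → Subset n → Subset n
image g S = tabulate λ x → lookup S (g ⟨$⟩ˡ x)

upFrom : Fin n → Subset n
upFrom i = tabulate λ x → ⌊ i Fin.≤? x ⌋

subsetsFrom : Fin n → ℕ → List (Subset n)
subsetsFrom i ℓ = filter (λ S → (S ⊆? upFrom i) ×-dec (∣ S ∣ ℕ.≟ ℓ)) (subsets _)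

------------------------------------------------------------------------
-- Permutation groups and switch tables

record IsSubgroup {g} (G : Pred (Permutation′ n) g) : Set g where
  field
    resp-≈    : ∀ {π ρ} → π ≈ ρ → G π → G ρ
    id-closed : G Perm.id
    ∘-closed  : ∀ {π ρ} → G π → G ρ → G (π ∘ₚ ρ)
    ⁻¹-closed : ∀ {π} → G π → G (Perm.flip π)

elements : ∀ {g} → Pred (Permutation′ n) g → Setoid g _
elements {n} G = On.setoid {B = ∃ G} (Fin n →-setoid Fin n) (λ π → proj₁ π ⟨$⟩ʳ_)

HasOrder : ∀ {g} → Pred (Permutation′ n) g → ℕ → Set g
HasOrder G k = Bijection (≡.setoid (Fin k)) (elements G)

Table : ℕ → Set
Table n = Fin n → Fin n → Permutation′ n

record Switches {g} (G : Pred (Permutation′ n) g) (i j : Fin n) (π : Permutation′ n) : Set g where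
  field
    member : G π
    moves  : π ⟨$⟩ʳ j ≡ i
    fixes  : ∀ t → t Fin.< i → π ⟨$⟩ʳ t ≡ t

record IsSwitchTable {g} (G : Pred (Permutation′ n) g) (σ : Table n) : Set g where
  field
    member    : ∀ i j → G (σ i j)
    switch    : ∀ {i j} → i Fin.< j → ∃ (Switches G i j) → Switches G i j (σ i j)
    otherwise : ∀ {i j} → ¬ (i Fin.< j × ∃ (Switches G i j)) → σ i j ≈ Perm.id

_≈?_ : (π ρ : Permutation′ n) → Dec (π ≈ ρ)
π ≈? ρ = Fin.all? λ x → (π ⟨$⟩ʳ x) Fin.≟ (ρ ⟨$⟩ʳ x)

module _ (σ : Table n) where

  J : Fin n → Subset n
  J i = tabulate λ j → ⌊ ¬? (σ i j ≈? Perm.id) ⌋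

  -- 0 if there is no effective row (trivial group).
  r : ℕ
  r = max 0 (map label (filter (λ i → nonempty? (J i)) (allFin n)))

  c : ℕ → ℕ
  c zero    = 0
  c (suc i) with i ℕ.<? n
  ... | yes i<n = ∣ J (fromℕ< i<n) ∣
  ... | no  _   = 0

  κ : ℕ → ℕ
  κ i = product (map (λ j → suc (c j)) (range i r))

  ----------------------------------------------------------------------
  -- Reduction factors and branch weights

  -- The number n - i + 1 of elements of {i,…,n}.
  size : ℕ → ℕ
  size i = suc n ∸ i

  ρ : ℕ → ℤ → ℚ
  ρ i (+ ℓ)    = if ⌊ 0 ℕ.<? ℓ ×-dec ℓ ℕ.<? size i ⌋ then ℓ ÷ size i else 0ℚ
  ρ i -[1+ _ ] = 0ℚ

  ρ̄ : ℕ → ℤ → ℚ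
  ρ̄ i (+ ℓ)    = if ⌊ 0 ℕ.<? ℓ ×-dec ℓ ℕ.<? size i ⌋ then 1ℚ ℚ.- (ℓ ÷ size i) else 0ℚ
  ρ̄ i -[1+ _ ] = 0ℚ

  -- x P ℓ is the falling factorial (x)_ℓ.  The value at negative ℓ is
  -- arbitrary: γ only occurs multiplied by ρ̄, which is 0 there.
  γ : ℕ → ℤ → ℚ
  γ i (+ ℓ)    = if ⌊ ℓ ℕ.≤? n ∸ i ∸ c i ⌋
                 then ((size i ∸ suc (c i)) P ℓ) ÷ (size i P ℓ)
                 else 0ℚ
  γ i -[1+ _ ] = 0ℚ

  α : Bool → ℕ → ℤ → ℚ
  α true  i ℓ = ρ i ℓ ℚ.* ρ i ℓ
  α false i ℓ = ρ̄ i ℓ ℚ.* γ i ℓ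

  -- The number of ones strictly before position t.
  onesBefore : Vec Bool p → Fin p → ℕ
  onesBefore (_     ∷ _) zero    = 0
  onesBefore (true  ∷ b) (suc t) = suc (onesBefore b t)
  onesBefore (false ∷ b) (suc t) = onesBefore b t

  w : ℕ → ℤ → Vec Bool p → ℚ
  w {p} i ℓ b = ∏[ t ∈ allFin p ] α (lookup b t) (i + toℕ t) (ℓ ℤ.- + onesBefore b t)

  ν : ℤ → Vec Bool p → ℚ
  ν ℓ b = ((ℓ ℤ.- + ∣ b ∣) ℤ.⊔ + 0) ℚ./ 1

  ----------------------------------------------------------------------
  -- The modified switch-table method and its typical cost

  -- The recursive calls (at the next level) issued by a call (S , S′) in row i
  -- that does not return early.  Each one is listed with the number of
  -- single-element evaluations spent on computing its second argument.
  calls : Fin n → Subset n → Subset n → List (ℕ × Subset n × Subset n)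
  calls i S S′ =
    if ⌊ i ∈? S ⌋
    then (if ⌊ i ∈? S′ ⌋ then (0 , S - i , S′ - i) ∷ [] else [])
         ++ map (λ j → (∣ S′ ∣ ∸ 1 , S - i , image (σ i j) (S′ - j))) (members (J i ∩ S′))
    else (if ⌊ i ∈? S′ ⌋ ∨ ⌊ nonempty? (J i ∩ S′) ⌋
          then []
          else (0 , S , S′)
               ∷ map (λ j → (∣ S′ ∣ , S , image (σ i j) S′)) (members (J i)))

  -- Expected number of evaluations of a call with cardinality ℓ, where the list
  -- holds the rows from the current level up to r (empty at level r + 1).  In
  -- the simplified model only the cardinality is passed on to a recursive call:
  -- its subsets are drawn afresh, independently and uniformly.
  expected : List (Fin n) → ℕ → ℚ
  expected []       ℓ = fromℕ ℓ
  expected (i ∷ is) ℓ =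
    if (ℓ ≡ᵇ 0) ∨ (ℓ ≡ᵇ size (label i))
    then 0ℚ
    else average (cartesianProduct (subsetsFrom i ℓ) (subsetsFrom i ℓ)) λ (S , S′) →
           ∑ (calls i S S′) λ (e , T , _) → fromℕ e ℚ.+ expected is ∣ T ∣

  E-mst : ℕ → ℚ
  E-mst m = expected (take r (allFin n)) m

{-# OPTIONS --safe #-}
module Submission where

-- A call at level i with 0 < ℓ < n - i + 1 spawns on average ρᵢ(ℓ)²(cᵢ + 1)
-- calls with cardinality ℓ - 1 and ρ̄ᵢ(ℓ)γᵢ(ℓ)(cᵢ + 1) calls with cardinality ℓ,
-- all but one in cᵢ + 1 of them at the price of an image: with N = n - i + 1,
-- the probabilities are the ratios of C(N-1,ℓ-1), C(N-1,ℓ) and C(N-1-cᵢ,ℓ) to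
-- C(N,ℓ).  The sums ∑ w ν over branch vectors obey the same recursion, by
-- splitting off the first branch, and unfolding both over the rows 1, …, r gives
-- the formula with ∏ (cⱼ + 1) in place of k.  That product is k because row i
-- together with the identity is a transversal of successive pointwise
-- stabilisers, and the stabiliser of 1, …, r is trivial.

open import Defs
open import Data.Bool.Base using (Bool; true; false; T; if_then_else_; _∧_; _∨_; not)
import Data.Bool.Properties as Bool
open import Data.Fin.Base using (Fin; zero; suc; toℕ)
import Data.Fin.Base as Fin
open import Data.Fin.Permutation using (Permutation′; _⟨$⟩ʳ_; _⟨$⟩ˡ_; _∘ₚ_; inverseˡ; inverseʳ)
import Data.Fin.Permutation as Perm
import Data.Fin.Properties as Fin
open import Data.Fin.Subset using (Subset; inside; outside; _∈_; _∉_; _⊆_; _∩_; _∪_; _─_; ⁅_⁆; ∣_∣; Nonempty)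
import Data.Fin.Subset as Subset
open import Data.Fin.Subset.Properties
open import Data.Integer.Base using (ℤ; +_)
import Data.Integer.Base as ℤ
import Data.Integer.Properties as ℤ
open import Data.List.Base using (List; []; _∷_; _++_; map; filter; foldr; length; take; upTo; applyUpTo; allFin; cartesianProduct)
import Data.List.Base as List
open import Data.List.Extrema.Nat using (xs≤max; max≤v⁺)
open import Data.List.Membership.Propositional.Properties using (∈-allFin; ∈-filter⁺; ∈-map⁺)
import Data.List.Properties as List
open import Data.List.Relation.Unary.All using (All; []; _∷_)
import Data.List.Relation.Unary.All as All
import Data.List.Relation.Unary.All.Properties as All
open import Data.Nat.Base using (ℕ; zero; suc; _∸_; _!; _≤_; _<_; z≤n; s≤s)
import Data.Nat.Base as ℕ
open import Data.Nat.Combinatorics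
open import Data.Nat.DivMod using (m/n*n≡m)
open import Data.Nat.Divisibility using (m*n∣o⇒n∣o/m; m≤n⇒m!∣n!)
import Data.Nat.Divisibility as ℕ
open import Data.Nat.Induction using (<-rec)
open import Data.Nat.ListAction using (product)
import Data.Nat.Properties as ℕ
open import Data.Nat.Tactic.RingSolver using () renaming (solve-∀ to ℕ-solve-∀)
open import Data.Product.Base using (∃; _×_; _,_; proj₁; proj₂)
open import Data.Rational.Base using (ℚ; 0ℚ; 1ℚ; _+_; _*_; _-_; toℚᵘ; fromℚᵘ)
import Data.Rational.Base as ℚ
open import Data.Rational.Properties hiding (_≟_; _≤?_; _<?_)
open import Data.Rational.Solver using (module +-*-Solver)
open import Data.Rational.Unnormalised.Base using (mkℚᵘ; *≡*)
import Data.Rational.Unnormalised.Base as ℚᵘ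
import Data.Rational.Unnormalised.Properties as ℚᵘ
open import Data.Sum.Base using (_⊎_; inj₁; inj₂; [_,_])
open import Data.Unit.Base using (tt)
open import Data.Vec.Base using (Vec; []; _∷_; here; there; lookup)
import Data.Vec.Base as Vec
import Data.Vec.Properties as Vec
open import Function.Base using (_∘_; id)
open import Function.Bundles using (Bijection; Equivalence; _⇔_; mk⇔)
open import Level using (Level)
open import Relation.Binary.Definitions using (tri<; tri≈; tri>)
open import Relation.Binary.PropositionalEquality using (_≡_; refl; sym; trans; cong; cong₂; subst; module ≡-Reasoning)
open import Relation.Nullary using (¬_; Dec; yes; no; contradiction)
open import Relation.Nullary.Decidable using (⌊_⌋; does; ¬?; _×-dec_; does-⇔; isYes≗does; dec-true; dec-false; decidable-stable)
open import Relation.Unary using (Pred; Decidable)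

open ≡-Reasoning
open +-*-Solver using (solve; _:=_; _:+_; _:*_; _:-_; con)

-- In the simplified model the cost of a call depends only on its level and its cardinality. One
-- call can therefore be averaged with an arbitrary cost function `E` for its children, and the sum
-- over pairs (S , S′) factors. The price of an image equals the cardinality of the call that
-- receives it: ℓ - 1 in the element branch, ℓ in the other. So the same node weight ν prices the
-- comparisons after row r and the images computed in row j, the latter summed over B_j. The factor
-- c_j / (c_j + 1) · k / κ_{j+1} is c_j · ∏_{t<j} (c_t + 1) in disguise; this division-free form is
-- the one that satisfies a recursion. Conventions have to match the algorithm at two places: the
-- early returns at ℓ = 0 and ℓ = N correspond to ρ = ρ̄ = 0, and the cutoff of γ corresponds to a
-- vanishing binomial coefficient. Averages and ratios are compared after multiplying by their
-- denominators, which leaves subsets to be counted.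

private
  variable
    ℓ₁ ℓ₂ ℓ₃ : Level
    A B : Set ℓ₁
    n p : ℕ

-- Rational arithmetic and finite sums

+-congˡ : ∀ p {q r} → q ≡ r → p + q ≡ p + r
+-congˡ p = cong (λ q → p + q)

-- `ℚ._/_` reduces fractions by a gcd, so identities between fractions are checked by
-- cross-multiplying unnormalised representatives and carried over by `fromℚᵘ`.
fromℚᵘ-homo-+ : ∀ p q → fromℚᵘ (p ℚᵘ.+ q) ≡ fromℚᵘ p + fromℚᵘ q
fromℚᵘ-homo-+ p q = toℚᵘ-injective (ℚᵘ.≃-trans (toℚᵘ-fromℚᵘ (p ℚᵘ.+ q))
  (ℚᵘ.≃-sym (ℚᵘ.≃-trans (toℚᵘ-homo-+ (fromℚᵘ p) (fromℚᵘ q))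
    (ℚᵘ.+-cong (toℚᵘ-fromℚᵘ p) (toℚᵘ-fromℚᵘ q)))))

fromℚᵘ-homo-* : ∀ p q → fromℚᵘ (p ℚᵘ.* q) ≡ fromℚᵘ p * fromℚᵘ q
fromℚᵘ-homo-* p q = toℚᵘ-injective (ℚᵘ.≃-trans (toℚᵘ-fromℚᵘ (p ℚᵘ.* q))
  (ℚᵘ.≃-sym (ℚᵘ.≃-trans (toℚᵘ-homo-* (fromℚᵘ p) (fromℚᵘ q))
    (ℚᵘ.*-cong (toℚᵘ-fromℚᵘ p) (toℚᵘ-fromℚᵘ q)))))

fromℕ-homo-+ : ∀ x y → fromℕ (x ℕ.+ y) ≡ fromℕ x + fromℕ y
fromℕ-homo-+ x y = begin
  fromℕ (x ℕ.+ y)                        ≡⟨ fromℚᵘ-cong {mkℚᵘ (+ (x ℕ.+ y)) 0} {mkℚᵘ (+ x) 0 ℚᵘ.+ mkℚᵘ (+ y) 0} (*≡* (cong (ℤ._* + 1) (sym (cong₂ ℤ._+_ (ℤ.*-identityʳ (+ x)) (ℤ.*-identityʳ (+ y)))))) ⟩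
  fromℚᵘ (mkℚᵘ (+ x) 0 ℚᵘ.+ mkℚᵘ (+ y) 0) ≡⟨ fromℚᵘ-homo-+ (mkℚᵘ (+ x) 0) (mkℚᵘ (+ y) 0) ⟩
  fromℕ x + fromℕ y                      ∎

fromℕ-homo-* : ∀ x y → fromℕ (x ℕ.* y) ≡ fromℕ x * fromℕ y
fromℕ-homo-* x y = begin
  fromℕ (x ℕ.* y)                        ≡⟨ fromℚᵘ-cong {mkℚᵘ (+ (x ℕ.* y)) 0} {mkℚᵘ (+ x) 0 ℚᵘ.* mkℚᵘ (+ y) 0} (*≡* (cong (ℤ._* + 1) (ℤ.pos-* x y))) ⟩
  fromℚᵘ (mkℚᵘ (+ x) 0 ℚᵘ.* mkℚᵘ (+ y) 0) ≡⟨ fromℚᵘ-homo-* (mkℚᵘ (+ x) 0) (mkℚᵘ (+ y) 0) ⟩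
  fromℕ x * fromℕ y                      ∎

÷-*-cancel : ∀ x y .{{_ : ℕ.NonZero y}} → (x ÷ y) * fromℕ y ≡ fromℕ x
÷-*-cancel x (suc y) = begin
  (x ÷ suc y) * fromℕ (suc y)                  ≡⟨ fromℚᵘ-homo-* (mkℚᵘ (+ x) y) (mkℚᵘ (+ suc y) 0) ⟨
  fromℚᵘ (mkℚᵘ (+ x) y ℚᵘ.* mkℚᵘ (+ suc y) 0)  ≡⟨ fromℚᵘ-cong {mkℚᵘ (+ x) y ℚᵘ.* mkℚᵘ (+ suc y) 0} {mkℚᵘ (+ x) 0} (*≡* (trans (ℤ.*-identityʳ (+ x ℤ.* + suc y)) (cong (λ z → + x ℤ.* + z) (sym (ℕ.*-identityʳ (suc y)))))) ⟩
  fromℕ x                                      ∎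

*-fromℕ-cancelʳ : ∀ y .{{_ : ℕ.NonZero y}} {p q} → p * fromℕ y ≡ q * fromℕ y → p ≡ q
*-fromℕ-cancelʳ y {p} {q} eq = begin
  p                          ≡⟨ regroup p ⟨
  p * fromℕ y * (1 ÷ y)      ≡⟨ cong (_* (1 ÷ y)) eq ⟩
  q * fromℕ y * (1 ÷ y)      ≡⟨ regroup q ⟩
  q                          ∎
  where
  regroup : ∀ p → p * fromℕ y * (1 ÷ y) ≡ p
  regroup p = begin
    p * fromℕ y * (1 ÷ y)    ≡⟨ *-assoc p (fromℕ y) (1 ÷ y) ⟩
    p * (fromℕ y * (1 ÷ y))  ≡⟨ cong (p *_) (trans (*-comm (fromℕ y) (1 ÷ y)) (÷-*-cancel 1 y)) ⟩
    p * 1ℚ                   ≡⟨ *-identityʳ p ⟩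
    p                        ∎

÷-unique : ∀ x y .{{_ : ℕ.NonZero y}} {q} → q * fromℕ y ≡ fromℕ x → x ÷ y ≡ q
÷-unique x y eq = *-fromℕ-cancelʳ y (trans (÷-*-cancel x y) (sym eq))

∑-cong-All : ∀ {xs : List A} {f g : A → ℚ} → All (λ x → f x ≡ g x) xs → ∑ xs f ≡ ∑ xs g
∑-cong-All []         = refl
∑-cong-All (eq ∷ eqs) = cong₂ _+_ eq (∑-cong-All eqs)

∑-cong : ∀ (xs : List A) {f g : A → ℚ} → (∀ x → f x ≡ g x) → ∑ xs f ≡ ∑ xs g
∑-cong []       eq = refl
∑-cong (x ∷ xs) eq = cong₂ _+_ (eq x) (∑-cong xs eq)

∑-++ : ∀ (xs ys : List A) (f : A → ℚ) → ∑ (xs ++ ys) f ≡ ∑ xs f + ∑ ys f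
∑-++ []       ys f = sym (+-identityˡ _)
∑-++ (x ∷ xs) ys f = trans (+-congˡ (f x) (∑-++ xs ys f)) (sym (+-assoc (f x) (∑ xs f) (∑ ys f)))

∑-map : ∀ (h : A → B) xs (f : B → ℚ) → ∑ (map h xs) f ≡ ∑ xs (f ∘ h)
∑-map h []       f = refl
∑-map h (x ∷ xs) f = +-congˡ (f (h x)) (∑-map h xs f)

∑-distrib-+ : ∀ (xs : List A) (f g : A → ℚ) → ∑ xs (λ x → f x + g x) ≡ ∑ xs f + ∑ xs g
∑-distrib-+ []       f g = refl
∑-distrib-+ (x ∷ xs) f g = trans (+-congˡ (f x + g x) (∑-distrib-+ xs f g))
  (solve 4 (λ a b c d → (a :+ b) :+ (c :+ d) := (a :+ c) :+ (b :+ d)) refl (f x) (g x) (∑ xs f) (∑ xs g))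

*-distribˡ-∑ : ∀ q (xs : List A) (f : A → ℚ) → ∑ xs (λ x → q * f x) ≡ q * ∑ xs f
*-distribˡ-∑ q []       f = sym (*-zeroʳ q)
*-distribˡ-∑ q (x ∷ xs) f = trans (+-congˡ (q * f x) (*-distribˡ-∑ q xs f)) (sym (*-distribˡ-+ q (f x) (∑ xs f)))

*-distribʳ-∑ : ∀ q (xs : List A) (f : A → ℚ) → ∑ xs (λ x → f x * q) ≡ ∑ xs f * q
*-distribʳ-∑ q xs f = trans (∑-cong xs (λ x → *-comm (f x) q))
  (trans (*-distribˡ-∑ q xs f) (*-comm q (∑ xs f)))

∑-zero : ∀ (xs : List A) → ∑ xs (λ _ → 0ℚ) ≡ 0ℚ
∑-zero []       = refl
∑-zero (x ∷ xs) = trans (+-identityˡ _) (∑-zero xs)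

∑-const : ∀ (xs : List A) q → ∑ xs (λ _ → q) ≡ fromℕ (length xs) * q
∑-const []       q = sym (*-zeroˡ q)
∑-const (x ∷ xs) q = begin
  q + ∑ xs (λ _ → q)             ≡⟨ +-congˡ q (∑-const xs q) ⟩
  q + fromℕ (length xs) * q      ≡⟨ solve 2 (λ q l → q :+ l :* q := (con 1ℚ :+ l) :* q) refl q (fromℕ (length xs)) ⟩
  (1ℚ + fromℕ (length xs)) * q   ≡⟨ cong (_* q) (fromℕ-homo-+ 1 (length xs)) ⟨
  fromℕ (suc (length xs)) * q    ∎

∑-comm : ∀ (xs : List A) (ys : List B) (f : A → B → ℚ) →
         ∑ xs (λ x → ∑ ys (f x)) ≡ ∑ ys (λ y → ∑ xs (λ x → f x y))
∑-comm []       ys f = sym (∑-zero ys)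
∑-comm (x ∷ xs) ys f = trans (+-congˡ (∑ ys (f x)) (∑-comm xs ys f))
  (sym (∑-distrib-+ ys (f x) (λ y → ∑ xs (λ x → f x y))))

∑-cartesianProduct : ∀ (xs : List A) (ys : List B) (f : A × B → ℚ) →
  ∑ (cartesianProduct xs ys) f ≡ ∑ xs (λ x → ∑ ys (λ y → f (x , y)))
∑-cartesianProduct []       ys f = refl
∑-cartesianProduct (x ∷ xs) ys f = trans (∑-++ (map (x ,_) ys) (cartesianProduct xs ys) f)
  (cong₂ _+_ (∑-map (x ,_) ys f) (∑-cartesianProduct xs ys f))

𝟙 : Bool → ℚ
𝟙 true  = 1ℚ
𝟙 false = 0ℚ

𝟙-∧ : ∀ x y → 𝟙 (x ∧ y) ≡ 𝟙 x * 𝟙 y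
𝟙-∧ true  y = sym (*-identityˡ (𝟙 y))
𝟙-∧ false y = sym (*-zeroˡ (𝟙 y))

-- With conditions turned into indicator factors, they can be multiplied, split and moved across a
-- change of summation order.
∑-filter : ∀ {Q : Pred A ℓ₂} (Q? : Decidable Q) xs (f : A → ℚ) →
           ∑ (filter Q? xs) f ≡ ∑ xs (λ x → 𝟙 (does (Q? x)) * f x)
∑-filter Q? []       f = refl
∑-filter Q? (x ∷ xs) f with does (Q? x)
... | true  = cong₂ _+_ (sym (*-identityˡ (f x))) (∑-filter Q? xs f)
... | false = begin
  ∑ (filter Q? xs) f    ≡⟨ ∑-filter Q? xs f ⟩
  rest                  ≡⟨ +-identityˡ rest ⟨
  0ℚ + rest             ≡⟨ cong (_+ rest) (*-zeroˡ (f x)) ⟨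
  0ℚ * f x + rest       ∎
  where rest = ∑ xs (λ x → 𝟙 (does (Q? x)) * f x)

-- Binomial coefficients and counting subsets

nC0≡1 : ∀ n → n C 0 ≡ 1
nC0≡1 n = trans (nCk≡nC[n∸k] {0} {n} z≤n) (nCn≡1 n)

nCk*k!≡nPk : ∀ n k → (n C k) ℕ.* k ! ≡ n P k
nCk*k!≡nPk n k with k ℕ.≤? n
... | no  k≰n = trans (cong (ℕ._* k !) (k>n⇒nCk≡0 (ℕ.≰⇒> k≰n))) (sym (k>n⇒nPk≡0 (ℕ.≰⇒> k≰n)))
... | yes k≤n = trans (cong (ℕ._* k !) (nCk≡nPk/k! k≤n))
  (m/n*n≡m (subst (λ x → k ! ℕ.∣ x) (sym (nPk≡n!/[n∸k]! k≤n)) (m*n∣o⇒n∣o/m ((n ∸ k) !) (k !) ([n∸k]!k!∣n! k≤n))))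
  where
  instance
    _ = k ℕ.!≢0
    _ = (n ∸ k) ℕ.!≢0

-- Absorption, the source of the probability ℓ / N that a fixed point lies in a random ℓ-subset.
-- After Pascal's rule one copy of `x` is set aside; the induction hypotheses at k and k + 1 then
-- apply to the rest, which reassembles to `suc n` further copies of `x`.
[k+1]*[n+1]C[k+1]≡[n+1]*nCk : ∀ n k → suc k ℕ.* (suc n C suc k) ≡ suc n ℕ.* (n C k)
[k+1]*[n+1]C[k+1]≡[n+1]*nCk zero    zero    = refl
[k+1]*[n+1]C[k+1]≡[n+1]*nCk zero    (suc k) = ℕ.*-zeroʳ (suc (suc k))
[k+1]*[n+1]C[k+1]≡[n+1]*nCk (suc n) zero    = begin
  1 ℕ.* (suc (suc n) C 1)  ≡⟨ cong (1 ℕ.*_) (nC1≡n (suc (suc n))) ⟩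
  1 ℕ.* suc (suc n)        ≡⟨ ℕ.*-comm 1 (suc (suc n)) ⟩
  suc (suc n) ℕ.* 1        ≡⟨ cong (suc (suc n) ℕ.*_) (nC0≡1 (suc n)) ⟨
  suc (suc n) ℕ.* (suc n C 0) ∎
[k+1]*[n+1]C[k+1]≡[n+1]*nCk (suc n) (suc k) = begin
  (2 ℕ.+ k) ℕ.* (suc (suc n) C suc (suc k))
    ≡⟨ cong ((2 ℕ.+ k) ℕ.*_) (nCk+nC[k+1]≡[n+1]C[k+1] (suc n) (suc k)) ⟨
  (2 ℕ.+ k) ℕ.* (x ℕ.+ y)
    ≡⟨ regroup k x y ⟩
  x ℕ.+ (suc k ℕ.* x ℕ.+ (2 ℕ.+ k) ℕ.* y)
    ≡⟨ cong (x ℕ.+_) (cong₂ ℕ._+_ ([k+1]*[n+1]C[k+1]≡[n+1]*nCk n k) ([k+1]*[n+1]C[k+1]≡[n+1]*nCk n (suc k))) ⟩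
  x ℕ.+ (suc n ℕ.* (n C k) ℕ.+ suc n ℕ.* (n C suc k))
    ≡⟨ cong (x ℕ.+_) (ℕ.*-distribˡ-+ (suc n) (n C k) (n C suc k)) ⟨
  x ℕ.+ suc n ℕ.* ((n C k) ℕ.+ (n C suc k))
    ≡⟨ cong (λ z → x ℕ.+ suc n ℕ.* z) (nCk+nC[k+1]≡[n+1]C[k+1] n k) ⟩
  suc (suc n) ℕ.* (suc n C suc k)
    ∎
  where
  regroup : ∀ k x y → (2 ℕ.+ k) ℕ.* (x ℕ.+ y) ≡ x ℕ.+ (suc k ℕ.* x ℕ.+ (2 ℕ.+ k) ℕ.* y)
  regroup = ℕ-solve-∀
  x = suc n C suc k
  y = suc n C suc (suc k)

∣p─q∣+∣q∣≡∣p∣ : ∀ {p q : Subset n} → q ⊆ p → ∣ p ─ q ∣ ℕ.+ ∣ q ∣ ≡ ∣ p ∣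
∣p─q∣+∣q∣≡∣p∣ {p = []} {[]} q⊆p = refl
∣p─q∣+∣q∣≡∣p∣ {p = outside ∷ p} {outside ∷ q} q⊆p = ∣p─q∣+∣q∣≡∣p∣ (drop-∷-⊆ q⊆p)
∣p─q∣+∣q∣≡∣p∣ {p = outside ∷ p} {inside  ∷ q} q⊆p = contradiction (q⊆p here) λ ()
∣p─q∣+∣q∣≡∣p∣ {p = inside  ∷ p} {outside ∷ q} q⊆p = cong suc (∣p─q∣+∣q∣≡∣p∣ (drop-∷-⊆ q⊆p))
∣p─q∣+∣q∣≡∣p∣ {p = inside  ∷ p} {inside  ∷ q} q⊆p =
  trans (ℕ.+-suc ∣ p ─ q ∣ ∣ q ∣) (cong suc (∣p─q∣+∣q∣≡∣p∣ (drop-∷-⊆ q⊆p)))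

x∈p⇒⁅x⁆⊆p : ∀ {p : Subset n} {x} → x ∈ p → ⁅ x ⁆ ⊆ p
x∈p⇒⁅x⁆⊆p {p = p} x∈p y∈ = subst (_∈ p) (sym (x∈⁅y⁆⇒x≡y _ y∈)) x∈p

suc∣p-x∣≡∣p∣ : ∀ {p : Subset n} {x} → x ∈ p → suc ∣ p Subset.- x ∣ ≡ ∣ p ∣
suc∣p-x∣≡∣p∣ {p = p} {x} x∈p = begin
  suc ∣ p Subset.- x ∣                ≡⟨ ℕ.+-comm 1 ∣ p Subset.- x ∣ ⟩
  ∣ p Subset.- x ∣ ℕ.+ 1              ≡⟨ cong (∣ p Subset.- x ∣ ℕ.+_) (∣⁅x⁆∣≡1 x) ⟨
  ∣ p Subset.- x ∣ ℕ.+ ∣ ⁅ x ⁆ ∣      ≡⟨ ∣p─q∣+∣q∣≡∣p∣ (x∈p⇒⁅x⁆⊆p x∈p) ⟩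
  ∣ p ∣                        ∎

x∈q⇒x∉p─q : ∀ {p q : Subset n} {x} → x ∈ q → x ∉ p ─ q
x∈q⇒x∉p─q {p = _ ∷ p} {inside ∷ q} here ()
x∈q⇒x∉p─q {p = _ ∷ p} {outside ∷ q} (there x∈q) (there x∈) = x∈q⇒x∉p─q x∈q x∈
x∈q⇒x∉p─q {p = _ ∷ p} {inside ∷ q} (there x∈q) (there x∈) = x∈q⇒x∉p─q x∈q x∈

∑-subsets : ∀ p (f : Subset (suc p) → ℚ) →
  ∑ (subsets (suc p)) f ≡ ∑ (subsets p) (f ∘ (outside ∷_)) + ∑ (subsets p) (f ∘ (inside ∷_))
∑-subsets p f = trans (∑-++ (map (outside ∷_) (subsets p)) (map (inside ∷_) (subsets p)) f)
  (cong₂ _+_ (∑-map (outside ∷_) (subsets p) f) (∑-map (inside ∷_) (subsets p) f))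

-- The test inside `subsetsFrom`, with `upFrom i` replaced by any `U`. This freedom allows the count
-- below to go by induction on `U`, where Pascal's rule is the split on the first point.
_⊆[_]?_ : ∀ (S : Subset n) ℓ U → Dec (S ⊆ U × ∣ S ∣ ≡ ℓ)
S ⊆[ ℓ ]? U = (S ⊆? U) ×-dec (∣ S ∣ ℕ.≟ ℓ)

∑-⊆-∣∣ : ∀ (U : Subset n) ℓ → ∑ (subsets n) (λ S → 𝟙 (does (S ⊆[ ℓ ]? U))) ≡ fromℕ (∣ U ∣ C ℓ)
∑-⊆-∣∣ []            zero    = refl
∑-⊆-∣∣ []            (suc ℓ) = refl
∑-⊆-∣∣ {suc n} (outside ∷ U) ℓ = begin
  ∑ (subsets (suc n)) (λ S → 𝟙 (does (S ⊆[ ℓ ]? (outside ∷ U))))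
    ≡⟨ ∑-subsets n _ ⟩
  ∑ (subsets n) (λ S → 𝟙 (does (S ⊆[ ℓ ]? U))) + ∑ (subsets n) (λ _ → 0ℚ)
    ≡⟨ cong₂ _+_ (∑-⊆-∣∣ U ℓ) (∑-zero (subsets n)) ⟩
  fromℕ (∣ U ∣ C ℓ) + 0ℚ
    ≡⟨ +-identityʳ _ ⟩
  fromℕ (∣ U ∣ C ℓ) ∎
∑-⊆-∣∣ {suc n} (inside ∷ U) zero = begin
  ∑ (subsets (suc n)) (λ S → 𝟙 (does (S ⊆[ 0 ]? (inside ∷ U))))
    ≡⟨ ∑-subsets n _ ⟩
  ∑ (subsets n) (λ S → 𝟙 (does (S ⊆[ 0 ]? U))) + ∑ (subsets n) (λ S → 𝟙 (does (S ⊆? U) ∧ false))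
    ≡⟨ cong₂ _+_ (∑-⊆-∣∣ U 0) (trans (∑-cong (subsets n) (λ S → cong 𝟙 (Bool.∧-zeroʳ (does (S ⊆? U))))) (∑-zero (subsets n))) ⟩
  fromℕ (∣ U ∣ C 0) + 0ℚ
    ≡⟨ +-identityʳ _ ⟩
  fromℕ (∣ U ∣ C 0)
    ≡⟨ cong fromℕ (trans (nC0≡1 ∣ U ∣) (sym (nC0≡1 (suc ∣ U ∣)))) ⟩
  fromℕ (suc ∣ U ∣ C 0) ∎
∑-⊆-∣∣ {suc n} (inside ∷ U) (suc ℓ) = begin
  ∑ (subsets (suc n)) (λ S → 𝟙 (does (S ⊆[ suc ℓ ]? (inside ∷ U))))
    ≡⟨ ∑-subsets n _ ⟩
  ∑ (subsets n) (λ S → 𝟙 (does (S ⊆[ suc ℓ ]? U))) + ∑ (subsets n) (λ S → 𝟙 (does (S ⊆[ ℓ ]? U)))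
    ≡⟨ cong₂ _+_ (∑-⊆-∣∣ U (suc ℓ)) (∑-⊆-∣∣ U ℓ) ⟩
  fromℕ (∣ U ∣ C suc ℓ) + fromℕ (∣ U ∣ C ℓ)
    ≡⟨ fromℕ-homo-+ (∣ U ∣ C suc ℓ) (∣ U ∣ C ℓ) ⟨
  fromℕ ((∣ U ∣ C suc ℓ) ℕ.+ (∣ U ∣ C ℓ))
    ≡⟨ cong fromℕ (trans (ℕ.+-comm (∣ U ∣ C suc ℓ) (∣ U ∣ C ℓ)) (nCk+nC[k+1]≡[n+1]C[k+1] ∣ U ∣ ℓ)) ⟩
  fromℕ (suc ∣ U ∣ C suc ℓ) ∎

∑-allFin : ∀ n (f : Fin (suc n) → ℚ) → ∑ (allFin (suc n)) f ≡ f zero + ∑ (allFin n) (f ∘ suc)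
∑-allFin n f = +-congˡ (f zero) (trans (cong (λ xs → ∑ xs f) (sym (List.map-tabulate id suc))) (∑-map suc (allFin n) f))

∑-members : ∀ (S : Subset n) (f : Fin n → ℚ) →
  ∑ (members S) f ≡ ∑ (allFin n) (λ j → 𝟙 (does (j ∈? S)) * f j)
∑-members S = ∑-filter (_∈? S) (allFin _)

∑𝟙∈≡∣S∣ : ∀ (S : Subset n) → ∑ (allFin n) (λ j → 𝟙 (does (j ∈? S))) ≡ fromℕ ∣ S ∣
∑𝟙∈≡∣S∣ []            = refl
∑𝟙∈≡∣S∣ {suc n} (outside ∷ S) = begin
  ∑ (allFin (suc n)) (λ j → 𝟙 (does (j ∈? (outside ∷ S))))  ≡⟨ ∑-allFin n (λ j → 𝟙 (does (j ∈? (outside ∷ S)))) ⟩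
  0ℚ + ∑ (allFin n) (λ j → 𝟙 (does (j ∈? S)))               ≡⟨ +-identityˡ _ ⟩
  ∑ (allFin n) (λ j → 𝟙 (does (j ∈? S)))                    ≡⟨ ∑𝟙∈≡∣S∣ S ⟩
  fromℕ ∣ S ∣                                               ∎
∑𝟙∈≡∣S∣ {suc n} (inside ∷ S) = begin
  ∑ (allFin (suc n)) (λ j → 𝟙 (does (j ∈? (inside ∷ S))))   ≡⟨ ∑-allFin n (λ j → 𝟙 (does (j ∈? (inside ∷ S)))) ⟩
  1ℚ + ∑ (allFin n) (λ j → 𝟙 (does (j ∈? S)))               ≡⟨ +-congˡ 1ℚ (∑𝟙∈≡∣S∣ S) ⟩
  1ℚ + fromℕ ∣ S ∣                                          ≡⟨ fromℕ-homo-+ 1 ∣ S ∣ ⟨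
  fromℕ (suc ∣ S ∣)                                         ∎

∑-members-const : ∀ (S : Subset n) q → ∑ (members S) (λ _ → q) ≡ fromℕ ∣ S ∣ * q
∑-members-const S q = begin
  ∑ (members S) (λ _ → q)                       ≡⟨ ∑-members S (λ _ → q) ⟩
  ∑ (allFin _) (λ j → 𝟙 (does (j ∈? S)) * q)    ≡⟨ *-distribʳ-∑ q (allFin _) (λ j → 𝟙 (does (j ∈? S))) ⟩
  ∑ (allFin _) (λ j → 𝟙 (does (j ∈? S))) * q    ≡⟨ cong (_* q) (∑𝟙∈≡∣S∣ S) ⟩
  fromℕ ∣ S ∣ * q                               ∎

fromℕ-injective : ∀ {x y} → fromℕ x ≡ fromℕ y → x ≡ y
fromℕ-injective {x} {y} eq with *≡* eq′ ← fromℚᵘ-injective {mkℚᵘ (+ x) 0} {mkℚᵘ (+ y) 0} eq =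
  ℤ.+-injective (trans (sym (ℤ.*-identityʳ (+ x))) (trans eq′ (ℤ.*-identityʳ (+ y))))

nPk*[n∸k]!≡n! : ∀ {n k} → k ≤ n → (n P k) ℕ.* (n ∸ k) ! ≡ n !
nPk*[n∸k]!≡n! {n} {k} k≤n = trans (cong (ℕ._* (n ∸ k) !) (nPk≡n!/[n∸k]! k≤n))
  (m/n*n≡m (m≤n⇒m!∣n! (ℕ.m∸n≤m n k)))
  where instance _ = (n ∸ k) ℕ.!≢0

nPk≢0 : ∀ {n k} → k ≤ n → ℕ.NonZero (n P k)
nPk≢0 {n} {k} k≤n = ℕ.m*n≢0⇒m≢0 (n P k) {{subst ℕ.NonZero (sym (nPk*[n∸k]!≡n! k≤n)) (n ℕ.!≢0)}}

nCk≢0 : ∀ {n k} → k ≤ n → ℕ.NonZero (n C k)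
nCk≢0 {n} {k} k≤n = ℕ.m*n≢0⇒m≢0 (n C k) {{subst ℕ.NonZero (sym (nCk*k!≡nPk n k)) (nPk≢0 k≤n)}}

-- The two falling factorials share the factor k!, so the transitivity gap is a ratio of binomial
-- coefficients. For k > m both sides are 0.
mPk÷nPk*nCk≡mCk : ∀ m {n k} → k ≤ n → ((m P k) ÷ (n P k)) * fromℕ (n C k) ≡ fromℕ (m C k)
mPk÷nPk*nCk≡mCk m {n} {k} k≤n = *-fromℕ-cancelʳ (k !) (begin
  x * fromℕ (n C k) * fromℕ (k !)    ≡⟨ *-assoc x (fromℕ (n C k)) (fromℕ (k !)) ⟩
  x * (fromℕ (n C k) * fromℕ (k !))  ≡⟨ cong (x *_) (fromℕ-homo-* (n C k) (k !)) ⟨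
  x * fromℕ ((n C k) ℕ.* k !)        ≡⟨ cong (λ y → x * fromℕ y) (nCk*k!≡nPk n k) ⟩
  x * fromℕ (n P k)                  ≡⟨ ÷-*-cancel (m P k) (n P k) ⟩
  fromℕ (m P k)                      ≡⟨ cong fromℕ (nCk*k!≡nPk m k) ⟨
  fromℕ ((m C k) ℕ.* k !)            ≡⟨ fromℕ-homo-* (m C k) (k !) ⟩
  fromℕ (m C k) * fromℕ (k !)        ∎)
  where
  x = (m P k) ÷ (n P k)
  instance
    _ = k ℕ.!≢0
    _ = nPk≢0 k≤n

[k+1]÷[n+1]*[n+1]C[k+1]≡nCk : ∀ n k → (suc k ÷ suc n) * fromℕ (suc n C suc k) ≡ fromℕ (n C k)
[k+1]÷[n+1]*[n+1]C[k+1]≡nCk n k = *-fromℕ-cancelʳ (suc n) (begin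
  x * y * fromℕ (suc n)                    ≡⟨ solve 3 (λ x y z → x :* y :* z := x :* z :* y) refl x y (fromℕ (suc n)) ⟩
  x * fromℕ (suc n) * y                    ≡⟨ cong (_* y) (÷-*-cancel (suc k) (suc n)) ⟩
  fromℕ (suc k) * y                        ≡⟨ fromℕ-homo-* (suc k) (suc n C suc k) ⟨
  fromℕ (suc k ℕ.* (suc n C suc k))        ≡⟨ cong fromℕ ([k+1]*[n+1]C[k+1]≡[n+1]*nCk n k) ⟩
  fromℕ (suc n ℕ.* (n C k))                ≡⟨ cong fromℕ (ℕ.*-comm (suc n) (n C k)) ⟩
  fromℕ ((n C k) ℕ.* suc n)                ≡⟨ fromℕ-homo-* (n C k) (suc n) ⟩
  fromℕ (n C k) * fromℕ (suc n)            ∎)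
  where
  x = suc k ÷ suc n
  y = fromℕ (suc n C suc k)

fromℕ-pascal : ∀ n k → fromℕ (suc n C suc k) ≡ fromℕ (n C k) + fromℕ (n C suc k)
fromℕ-pascal n k = trans (cong fromℕ (sym (nCk+nC[k+1]≡[n+1]C[k+1] n k))) (fromℕ-homo-+ (n C k) (n C suc k))

[1-[k+1]÷[n+1]]*[n+1]C[k+1]≡nC[k+1] : ∀ n k →
  (1ℚ - (suc k ÷ suc n)) * fromℕ (suc n C suc k) ≡ fromℕ (n C suc k)
[1-[k+1]÷[n+1]]*[n+1]C[k+1]≡nC[k+1] n k = begin
  (1ℚ - x) * y                                      ≡⟨ solve 2 (λ x y → (con 1ℚ :- x) :* y := y :- x :* y) refl x y ⟩
  y - x * y                                         ≡⟨ cong₂ _-_ (fromℕ-pascal n k) ([k+1]÷[n+1]*[n+1]C[k+1]≡nCk n k) ⟩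
  fromℕ (n C k) + fromℕ (n C suc k) - fromℕ (n C k) ≡⟨ solve 2 (λ x y → x :+ y :- x := y) refl (fromℕ (n C k)) (fromℕ (n C suc k)) ⟩
  fromℕ (n C suc k)                                 ∎
  where
  x = suc k ÷ suc n
  y = fromℕ (suc n C suc k)

⌊⌋-true : (a? : Dec A) → A → ⌊ a? ⌋ ≡ true
⌊⌋-true a? x = trans (isYes≗does a?) (dec-true a? x)

⌊⌋-false : (a? : Dec A) → ¬ A → ⌊ a? ⌋ ≡ false
⌊⌋-false a? ¬x = trans (isYes≗does a?) (dec-false a? ¬x)

∈-tabulate⁺ : ∀ {Q : Pred (Fin n) ℓ₂} (Q? : Decidable Q) {x} → Q x → x ∈ Vec.tabulate (λ y → ⌊ Q? y ⌋)
∈-tabulate⁺ Q? {x} qx = Vec.lookup⇒[]= x _ (trans (Vec.lookup∘tabulate _ x) (⌊⌋-true (Q? x) qx))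

∈-tabulate⁻ : ∀ {Q : Pred (Fin n) ℓ₂} (Q? : Decidable Q) {x} → x ∈ Vec.tabulate (λ y → ⌊ Q? y ⌋) → Q x
∈-tabulate⁻ Q? {x} x∈ with Q? x | trans (sym (Vec.lookup∘tabulate (λ y → ⌊ Q? y ⌋) x)) (Vec.[]=⇒lookup x∈)
... | yes qx | _  = qx
... | no  _  | ()

∣upFrom∣ : ∀ (i : Fin n) → ∣ upFrom i ∣ ≡ n ∸ toℕ i
∣upFrom∣ zero = all-inside _
  where
  all-inside : ∀ n → ∣ Vec.tabulate {n = n} (λ _ → inside) ∣ ≡ n
  all-inside zero    = refl
  all-inside (suc n) = cong suc (all-inside n)
∣upFrom∣ {suc n} (suc i) = trans (cong (λ (U : Subset n) → ∣ U ∣) (Vec.tabulate-cong (λ x → ⌊⌋-⇔ (i Fin.≤? x) (suc i Fin.≤? suc x)))) (∣upFrom∣ i)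
  where
  ⌊⌋-⇔ : ∀ {x y} (d : Dec (x ≤ y)) (e : Dec (suc x ≤ suc y)) → ⌊ e ⌋ ≡ ⌊ d ⌋
  ⌊⌋-⇔ (yes x≤y) e = ⌊⌋-true e (s≤s x≤y)
  ⌊⌋-⇔ (no  x≰y) e = ⌊⌋-false e (x≰y ∘ ℕ.≤-pred)

-- Counting the ℓ-subsets of {i,...,n} that avoid or contain given points

module _ (i : Fin n) (ℓ : ℕ) where

  -- Covers the conditions that merely confine S to a smaller set `U`. Avoiding points is such a
  -- condition; containing a point is not and is reached through the complement.
  ∑-subsetsFrom : ∀ {Q : Pred (Subset n) ℓ₂} (Q? : Decidable Q) U →
    (∀ {S} → ((S ⊆ upFrom i × ∣ S ∣ ≡ ℓ) × Q S) ⇔ (S ⊆ U × ∣ S ∣ ≡ ℓ)) →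
    ∑ (subsetsFrom i ℓ) (λ S → 𝟙 (does (Q? S))) ≡ fromℕ (∣ U ∣ C ℓ)
  ∑-subsetsFrom Q? U Q⇔ = begin
    ∑ (subsetsFrom i ℓ) (λ S → 𝟙 (does (Q? S)))
      ≡⟨ ∑-filter (_⊆[ ℓ ]? upFrom i) (subsets n) _ ⟩
    ∑ (subsets n) (λ S → 𝟙 (does (S ⊆[ ℓ ]? upFrom i)) * 𝟙 (does (Q? S)))
      ≡⟨ ∑-cong (subsets n) (λ S → trans (sym (𝟙-∧ (does (S ⊆[ ℓ ]? upFrom i)) (does (Q? S))))
           (cong 𝟙 (does-⇔ Q⇔ ((S ⊆[ ℓ ]? upFrom i) ×-dec Q? S) (S ⊆[ ℓ ]? U)))) ⟩
    ∑ (subsets n) (λ S → 𝟙 (does (S ⊆[ ℓ ]? U)))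
      ≡⟨ ∑-⊆-∣∣ U ℓ ⟩
    fromℕ (∣ U ∣ C ℓ) ∎

  ∑-subsetsFrom-disjoint : ∀ {Q : Pred (Subset n) ℓ₂} (Q? : Decidable Q) {V} → V ⊆ upFrom i →
    (∀ {S} → Q S ⇔ (∀ x → x ∈ S → x ∉ V)) →
    ∑ (subsetsFrom i ℓ) (λ S → 𝟙 (does (Q? S))) ≡ fromℕ ((n ∸ toℕ i ∸ ∣ V ∣) C ℓ)
  ∑-subsetsFrom-disjoint Q? {V} V⊆ Q⇔ = trans
    (∑-subsetsFrom Q? (upFrom i ─ V) (mk⇔
      (λ ((S⊆ , ∣S∣) , q) → (λ x∈S → x∈p∧x∉q⇒x∈p─q (S⊆ x∈S) (Equivalence.to Q⇔ q _ x∈S)) , ∣S∣)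
      (λ (S⊆ , ∣S∣) → ((p─q⊆p (upFrom i) V ∘ S⊆) , ∣S∣) ,
        Equivalence.from Q⇔ (λ _ x∈S x∈V → x∈q⇒x∉p─q x∈V (S⊆ x∈S)))))
    (cong (λ k → fromℕ (k C ℓ)) (begin
      ∣ upFrom i ─ V ∣                       ≡⟨ ℕ.m+n∸n≡m ∣ upFrom i ─ V ∣ ∣ V ∣ ⟨
      ∣ upFrom i ─ V ∣ ℕ.+ ∣ V ∣ ∸ ∣ V ∣     ≡⟨ cong (_∸ ∣ V ∣) (∣p─q∣+∣q∣≡∣p∣ V⊆) ⟩
      ∣ upFrom i ∣ ∸ ∣ V ∣                   ≡⟨ cong (_∸ ∣ V ∣) (∣upFrom∣ i) ⟩
      n ∸ toℕ i ∸ ∣ V ∣                      ∎))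

  length-subsetsFrom : length (subsetsFrom i ℓ) ≡ (n ∸ toℕ i) C ℓ
  length-subsetsFrom = fromℕ-injective (begin
    fromℕ (length (subsetsFrom i ℓ))       ≡⟨ *-identityʳ _ ⟨
    fromℕ (length (subsetsFrom i ℓ)) * 1ℚ  ≡⟨ ∑-const (subsetsFrom i ℓ) 1ℚ ⟨
    ∑ (subsetsFrom i ℓ) (λ _ → 1ℚ)         ≡⟨ ∑-subsetsFrom (λ _ → yes tt) (upFrom i) (mk⇔ proj₁ (_, tt)) ⟩
    fromℕ (∣ upFrom i ∣ C ℓ)               ≡⟨ cong (λ k → fromℕ (k C ℓ)) (∣upFrom∣ i) ⟩
    fromℕ ((n ∸ toℕ i) C ℓ)                ∎)

  ∑-∌ : ∀ {j} → j ∈ upFrom i →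
    ∑ (subsetsFrom i ℓ) (λ S → 𝟙 (not (does (j ∈? S)))) ≡ fromℕ ((n ∸ toℕ i ∸ 1) C ℓ)
  ∑-∌ {j} j∈ = trans
    (∑-subsetsFrom-disjoint (λ S → ¬? (j ∈? S)) (x∈p⇒⁅x⁆⊆p j∈) (mk⇔
      (λ j∉S _ x∈S x∈ → j∉S (subst (_∈ _) (x∈⁅y⁆⇒x≡y _ x∈) x∈S))
      (λ S∩j j∈S → S∩j j j∈S (x∈⁅x⁆ j))))
    (cong (λ k → fromℕ ((n ∸ toℕ i ∸ k) C ℓ)) (∣⁅x⁆∣≡1 j))

  ∑-∋+∑-∌ : ∀ j → ∑ (subsetsFrom i ℓ) (λ S → 𝟙 (does (j ∈? S)))
                + ∑ (subsetsFrom i ℓ) (λ S → 𝟙 (not (does (j ∈? S))))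
                ≡ fromℕ ((n ∸ toℕ i) C ℓ)
  ∑-∋+∑-∌ j = begin
    ∑ xs f + ∑ xs g              ≡⟨ ∑-distrib-+ xs f g ⟨
    ∑ xs (λ S → f S + g S)       ≡⟨ ∑-cong xs (λ S → 𝟙+𝟙-not (does (j ∈? S))) ⟩
    ∑ xs (λ S → 1ℚ)              ≡⟨ ∑-const xs 1ℚ ⟩
    fromℕ (length xs) * 1ℚ       ≡⟨ *-identityʳ _ ⟩
    fromℕ (length xs)            ≡⟨ cong fromℕ length-subsetsFrom ⟩
    fromℕ ((n ∸ toℕ i) C ℓ)      ∎
    where
    xs = subsetsFrom i ℓ
    f g : Subset n → ℚ
    f S = 𝟙 (does (j ∈? S))
    g S = 𝟙 (not (does (j ∈? S)))
    𝟙+𝟙-not : ∀ b → 𝟙 b + 𝟙 (not b) ≡ 1ℚ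
    𝟙+𝟙-not true  = refl
    𝟙+𝟙-not false = refl

-- All subsets minus those that avoid j; Pascal's rule evaluates the difference.
∑-∋ : ∀ (i : Fin n) ℓ {j} → j ∈ upFrom i →
  ∑ (subsetsFrom i (suc ℓ)) (λ S → 𝟙 (does (j ∈? S))) ≡ fromℕ ((n ∸ toℕ i ∸ 1) C ℓ)
∑-∋ {n} i ℓ {j} j∈ = begin
  in′                                              ≡⟨ solve 2 (λ x y → x := x :+ y :- y) refl in′ out ⟩
  in′ + out - out                                  ≡⟨ cong₂ _-_ (trans (∑-∋+∑-∌ i (suc ℓ) j) (cong (λ k → fromℕ (k C suc ℓ)) (sym N≡))) (∑-∌ i (suc ℓ) j∈) ⟩
  fromℕ (suc N′ C suc ℓ) - fromℕ (N′ C suc ℓ)      ≡⟨ cong (_- fromℕ (N′ C suc ℓ)) (fromℕ-pascal N′ ℓ) ⟩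
  fromℕ (N′ C ℓ) + fromℕ (N′ C suc ℓ) - fromℕ (N′ C suc ℓ)
                                                   ≡⟨ solve 2 (λ x y → x :+ y :- y := x) refl (fromℕ (N′ C ℓ)) (fromℕ (N′ C suc ℓ)) ⟩
  fromℕ (N′ C ℓ)                                   ∎
  where
  in′ = ∑ (subsetsFrom i (suc ℓ)) (λ S → 𝟙 (does (j ∈? S)))
  out = ∑ (subsetsFrom i (suc ℓ)) (λ S → 𝟙 (not (does (j ∈? S))))
  N′ = n ∸ toℕ i ∸ 1
  N≡ : suc N′ ≡ n ∸ toℕ i
  N≡ = ℕ.m+[n∸m]≡n (ℕ.m<n⇒0<n∸m (Fin.toℕ<n i))

-- The average cost of one call

-- This is where the independence of S and S′ enters.
∑-factor : ∀ {A B : Set} (xs : List A) (ys : List B) (f : A → ℚ) (g : B → ℚ) →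
           ∑ xs (λ x → ∑ ys (λ y → f x * g y)) ≡ ∑ xs f * ∑ ys g
∑-factor xs ys f g = trans (∑-cong xs (λ x → *-distribˡ-∑ (f x) ys g)) (*-distribʳ-∑ (∑ ys g) xs f)

branch-regroup : ∀ a b L k x u → a * L * (b * L * (x + k * (u + x))) ≡ a * b * ((1ℚ + k) * x + k * u) * (L * L)
branch-regroup a b L k x u = trans
  (solve 4 (λ a b L y → a :* L :* (b :* L :* y) := a :* b :* y :* (L :* L)) refl a b L (x + k * (u + x)))
  (cong (λ y → a * b * y * (L * L)) (solve 3 (λ k x u → x :+ k :* (u :+ x) := (con 1ℚ :+ k) :* x :+ k :* u) refl k x u))

-- `L` is the number of ℓ-subsets, so `r * L`, `r̄ * L` and `g * L` are counts of subsets. In either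
-- branch `x` or `y` is the cost of a child and `u` or `v` the price of an image; the unswitched
-- call joins the `k` switched ones in the factor 1 + k, while only the latter pay.
average-numerator : ∀ r r̄ g L k x y u v →
  r * L * (r * L * x + k * (r * L * (u + x))) + r̄ * L * (g * L * (y + k * (v + y)))
    ≡ (r * r * ((1ℚ + k) * x + k * u) + r̄ * g * ((1ℚ + k) * y + k * v)) * (L * L)
average-numerator r r̄ g L k x y u v = begin
  r * L * (r * L * x + k * (r * L * (u + x))) + out
    ≡⟨ cong (λ z → r * L * z + out) (solve 4 (λ r k x u → r :* x :+ k :* (r :* u) := r :* (x :+ k :* u)) refl (r * L) k x (u + x)) ⟩
  r * L * (r * L * (x + k * (u + x))) + out
    ≡⟨ cong₂ _+_ (branch-regroup r r L k x u) (branch-regroup r̄ g L k y v) ⟩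
  r * r * ((1ℚ + k) * x + k * u) * (L * L) + r̄ * g * ((1ℚ + k) * y + k * v) * (L * L)
    ≡⟨ *-distribʳ-+ (L * L) (r * r * ((1ℚ + k) * x + k * u)) (r̄ * g * ((1ℚ + k) * y + k * v)) ⟨
  (r * r * ((1ℚ + k) * x + k * u) + r̄ * g * ((1ℚ + k) * y + k * v)) * (L * L) ∎
  where out = r̄ * L * (g * L * (y + k * (v + y)))

length-cartesianProduct : ∀ {A B : Set} (xs : List A) (ys : List B) →
                          length (cartesianProduct xs ys) ≡ length xs ℕ.* length ys
length-cartesianProduct []       ys = refl
length-cartesianProduct (x ∷ xs) ys = trans (List.length-++ (map (x ,_) ys))
  (cong₂ ℕ._+_ (List.length-map (x ,_) ys) (length-cartesianProduct xs ys))

-- Isolates the division by the number of pairs, so that the averaging argument deals with plain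
-- sums.
average-normalise : ∀ {A : Set} (xs : List A) .{{_ : ℕ.NonZero (length xs)}} (f : A × A → ℚ) q →
  ∑ (cartesianProduct xs xs) f ≡ q * (fromℕ (length xs) * fromℕ (length xs)) →
  average (cartesianProduct xs xs) f ≡ q
average-normalise xs f q eq = begin
  (1 ÷ length (cartesianProduct xs xs)) * ∑ (cartesianProduct xs xs) f
    ≡⟨ cong₂ (λ l s → (1 ÷ l) * s) (length-cartesianProduct xs xs) eq ⟩
  (1 ÷ (l ℕ.* l)) * (q * (fromℕ l * fromℕ l))
    ≡⟨ cong (λ s → (1 ÷ (l ℕ.* l)) * (q * s)) (fromℕ-homo-* l l) ⟨
  (1 ÷ (l ℕ.* l)) * (q * fromℕ (l ℕ.* l))
    ≡⟨ solve 3 (λ x y z → x :* (y :* z) := x :* z :* y) refl (1 ÷ (l ℕ.* l)) q (fromℕ (l ℕ.* l)) ⟩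
  (1 ÷ (l ℕ.* l)) * fromℕ (l ℕ.* l) * q
    ≡⟨ cong (_* q) (÷-*-cancel 1 (l ℕ.* l) {{ℕ.m*n≢0 l l}}) ⟩
  1ℚ * q
    ≡⟨ *-identityˡ q ⟩
  q ∎
  where l = length xs

module _ (σ : Table n) (i : Fin n) where

  c-label : c σ (label i) ≡ ∣ J σ i ∣
  c-label with toℕ i ℕ.<? n
  ... | yes i<n = cong (λ j → ∣ J σ j ∣) (Fin.fromℕ<-toℕ i i<n)
  ... | no  i≮n = contradiction (Fin.toℕ<n i) i≮n

  ρ-inner : ∀ {ℓ} → 0 < ℓ → ℓ < n ∸ toℕ i → ρ σ (label i) (+ ℓ) ≡ ℓ ÷ (n ∸ toℕ i)
  ρ-inner {ℓ} 0<ℓ ℓ<N = cong (λ b → if b then ℓ ÷ (n ∸ toℕ i) else 0ℚ)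
    (⌊⌋-true ((0 ℕ.<? ℓ) ×-dec (ℓ ℕ.<? (n ∸ toℕ i))) (0<ℓ , ℓ<N))

  ρ̄-inner : ∀ {ℓ} → 0 < ℓ → ℓ < n ∸ toℕ i → ρ̄ σ (label i) (+ ℓ) ≡ 1ℚ - (ℓ ÷ (n ∸ toℕ i))
  ρ̄-inner {ℓ} 0<ℓ ℓ<N = cong (λ b → if b then 1ℚ - (ℓ ÷ (n ∸ toℕ i)) else 0ℚ)
    (⌊⌋-true ((0 ℕ.<? ℓ) ×-dec (ℓ ℕ.<? (n ∸ toℕ i))) (0<ℓ , ℓ<N))

  n∸label : n ∸ label i ≡ n ∸ toℕ i ∸ 1
  n∸label = trans (cong (n ∸_) (ℕ.+-comm 1 (toℕ i))) (sym (ℕ.∸-+-assoc n (toℕ i) 1))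

  -- The case split follows the cutoff in the definition of `γ`: beyond it fewer than ℓ points
  -- remain, and the binomial coefficient on the right vanishes as well.
  γ*nCℓ : ∀ {ℓ} → ℓ ≤ n ∸ toℕ i →
    γ σ (label i) (+ ℓ) * fromℕ ((n ∸ toℕ i) C ℓ) ≡ fromℕ ((n ∸ toℕ i ∸ suc ∣ J σ i ∣) C ℓ)
  γ*nCℓ {ℓ} ℓ≤N = by-cases (ℓ ℕ.≤? n ∸ label i ∸ c σ (label i))
    where
    M≡ : n ∸ label i ∸ c σ (label i) ≡ n ∸ toℕ i ∸ suc ∣ J σ i ∣
    M≡ = trans (cong₂ _∸_ n∸label c-label) (ℕ.∸-+-assoc (n ∸ toℕ i) 1 ∣ J σ i ∣)
    ratio = ((n ∸ toℕ i ∸ suc (c σ (label i))) P ℓ) ÷ ((n ∸ toℕ i) P ℓ)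
    by-cases : (d : Dec (ℓ ≤ n ∸ label i ∸ c σ (label i))) →
      (if ⌊ d ⌋ then ratio else 0ℚ) * fromℕ ((n ∸ toℕ i) C ℓ) ≡ fromℕ ((n ∸ toℕ i ∸ suc ∣ J σ i ∣) C ℓ)
    by-cases (yes _)   = trans (mPk÷nPk*nCk≡mCk (n ∸ toℕ i ∸ suc (c σ (label i))) ℓ≤N)
      (cong (λ k → fromℕ ((n ∸ toℕ i ∸ suc k) C ℓ)) c-label)
    by-cases (no ℓ≰M) = trans (*-zeroˡ (fromℕ ((n ∸ toℕ i) C ℓ)))
      (cong fromℕ (sym (k>n⇒nCk≡0 (subst (λ m → m < ℓ) M≡ (ℕ.≰⇒> ℓ≰M)))))

  module _ (J⊆ : J σ i ⊆ upFrom i) (i∉J : i ∉ J σ i) (E : ℕ → ℚ) where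

    -- `E` stands for the expected cost of a child and is left arbitrary, so that averaging one call
    -- needs no induction over the rows.
    cost : ℕ × Subset n × Subset n → ℚ
    cost (e , T , _) = fromℕ e + E ∣ T ∣

    disjoint? : Decidable (λ (S : Subset n) → i ∉ S × ¬ Nonempty (J σ i ∩ S))
    disjoint? S = ¬? (i ∈? S) ×-dec ¬? (nonempty? (J σ i ∩ S))

    -- Each summand is a function of S times a function of S′, the shape required by `∑-factor`. The
    -- permutations disappear because a child is charged by the cardinality of its first subset
    -- alone.
    ∑-calls : ∀ {ℓ S S′} → ∣ S ∣ ≡ suc ℓ → ∣ S′ ∣ ≡ suc ℓ →
      ∑ (calls σ i S S′) cost
        ≡ 𝟙 (does (i ∈? S)) * (𝟙 (does (i ∈? S′)) * E ℓ + ∑ (members (J σ i ∩ S′)) (λ _ → fromℕ ℓ + E ℓ))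
          + 𝟙 (not (does (i ∈? S))) * (𝟙 (does (disjoint? S′))
            * (E (suc ℓ) + fromℕ ∣ J σ i ∣ * (fromℕ (suc ℓ) + E (suc ℓ))))
    ∑-calls {ℓ} {S} {S′} ∣S∣ ∣S′∣ = by-cases (i ∈? S) (i ∈? S′) (nonempty? (J σ i ∩ S′))
      where
      kept : List (ℕ × Subset n × Subset n)
      kept = (0 , S Subset.- i , S′ Subset.- i) ∷ []
      switched : Fin n → ℕ × Subset n × Subset n
      switched j = ∣ S′ ∣ ∸ 1 , S Subset.- i , image (σ i j) (S′ Subset.- j)
      switched′ : Fin n → ℕ × Subset n × Subset n
      switched′ j = ∣ S′ ∣ , S , image (σ i j) S′
      js = members (J σ i ∩ S′)
      js-cost = ∑ js (λ _ → fromℕ ℓ + E ℓ)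
      out-cost = E (suc ℓ) + fromℕ ∣ J σ i ∣ * (fromℕ (suc ℓ) + E (suc ℓ))

      kept-cost : i ∈ S → (b : Dec (i ∈ S′)) → ∑ (if ⌊ b ⌋ then kept else []) cost ≡ 𝟙 (does b) * E ℓ
      kept-cost i∈S (yes _) = begin
        0ℚ + E (∣ S Subset.- i ∣) + 0ℚ  ≡⟨ +-identityʳ _ ⟩
        0ℚ + E (∣ S Subset.- i ∣)       ≡⟨ +-identityˡ _ ⟩
        E (∣ S Subset.- i ∣)            ≡⟨ cong E (ℕ.suc-injective (trans (suc∣p-x∣≡∣p∣ i∈S) ∣S∣)) ⟩
        E ℓ                             ≡⟨ *-identityˡ (E ℓ) ⟨
        1ℚ * E ℓ                        ∎
      kept-cost i∈S (no _) = sym (*-zeroˡ (E ℓ))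

      switched-cost : i ∈ S → ∑ (map switched js) cost ≡ js-cost
      switched-cost i∈S = trans (∑-map switched js cost) (∑-cong js (λ _ →
        cong₂ (λ x y → fromℕ x + E y) (cong (_∸ 1) ∣S′∣) (ℕ.suc-injective (trans (suc∣p-x∣≡∣p∣ i∈S) ∣S∣))))

      out-cost≡ : ∑ ((0 , S , S′) ∷ map switched′ (members (J σ i))) cost ≡ out-cost
      out-cost≡ = cong₂ _+_
        (trans (+-identityˡ _) (cong E ∣S∣))
        (begin
          ∑ (map switched′ (members (J σ i))) cost
            ≡⟨ ∑-map switched′ (members (J σ i)) cost ⟩
          ∑ (members (J σ i)) (λ _ → fromℕ (∣ S′ ∣) + E (∣ S ∣))
            ≡⟨ cong₂ (λ x y → ∑ (members (J σ i)) (λ _ → fromℕ x + E y)) ∣S′∣ ∣S∣ ⟩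
          ∑ (members (J σ i)) (λ _ → fromℕ (suc ℓ) + E (suc ℓ))
            ≡⟨ ∑-members-const (J σ i) (fromℕ (suc ℓ) + E (suc ℓ)) ⟩
          fromℕ ∣ J σ i ∣ * (fromℕ (suc ℓ) + E (suc ℓ)) ∎)

      1x+0y≡x : ∀ x y → 1ℚ * x + 0ℚ * y ≡ x
      1x+0y≡x x y = trans (cong₂ _+_ (*-identityˡ x) (*-zeroˡ y)) (+-identityʳ x)

      0x+1y≡y : ∀ x y → 0ℚ * x + 1ℚ * y ≡ y
      0x+1y≡y x y = trans (cong₂ _+_ (*-zeroˡ x) (*-identityˡ y)) (+-identityˡ y)

      by-cases : (a : Dec (i ∈ S)) (b : Dec (i ∈ S′)) (d : Dec (Nonempty (J σ i ∩ S′))) →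
        ∑ (if ⌊ a ⌋
           then (if ⌊ b ⌋ then kept else []) ++ map switched js
           else (if ⌊ b ⌋ ∨ ⌊ d ⌋ then [] else (0 , S , S′) ∷ map switched′ (members (J σ i)))) cost
        ≡ 𝟙 (does a) * (𝟙 (does b) * E ℓ + js-cost)
          + 𝟙 (not (does a)) * (𝟙 (not (does b) ∧ not (does d)) * out-cost)
      by-cases (yes i∈S) b d = begin
        ∑ ((if ⌊ b ⌋ then kept else []) ++ map switched js) cost
          ≡⟨ ∑-++ (if ⌊ b ⌋ then kept else []) (map switched js) cost ⟩
        ∑ (if ⌊ b ⌋ then kept else []) cost + ∑ (map switched js) cost
          ≡⟨ cong₂ _+_ (kept-cost i∈S b) (switched-cost i∈S) ⟩
        𝟙 (does b) * E ℓ + js-cost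
          ≡⟨ 1x+0y≡x _ (𝟙 (not (does b) ∧ not (does d)) * out-cost) ⟨
        1ℚ * (𝟙 (does b) * E ℓ + js-cost) + 0ℚ * (𝟙 (not (does b) ∧ not (does d)) * out-cost) ∎
      by-cases (no _) (yes _) d =
        sym (trans (0x+1y≡y (1ℚ * E ℓ + js-cost) (0ℚ * out-cost)) (*-zeroˡ out-cost))
      by-cases (no _) (no _) (yes _) =
        sym (trans (0x+1y≡y (0ℚ * E ℓ + js-cost) (0ℚ * out-cost)) (*-zeroˡ out-cost))
      by-cases (no _) (no _) (no _) = trans out-cost≡
        (sym (trans (0x+1y≡y (0ℚ * E ℓ + js-cost) (1ℚ * out-cost)) (*-identityˡ out-cost)))

    -- The non-element branch survives when S′ avoids `V`, that is i together with J(i). As i ∉ J(i)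
    -- and both lie in {i,...,n}, these are c_i + 1 points removed from the N available ones.
    ∑-disjoint : ∀ ℓ → ∑ (subsetsFrom i ℓ) (λ S → 𝟙 (does (disjoint? S))) ≡ fromℕ ((n ∸ toℕ i ∸ suc ∣ J σ i ∣) C ℓ)
    ∑-disjoint ℓ = trans
      (∑-subsetsFrom-disjoint i ℓ disjoint? V⊆ (mk⇔ to from))
      (cong (λ k → fromℕ ((n ∸ toℕ i ∸ k) C ℓ)) ∣V∣)
      where
      V = ⁅ i ⁆ ∪ J σ i
      V⊆ : V ⊆ upFrom i
      V⊆ x∈ with x∈p∪q⁻ ⁅ i ⁆ (J σ i) x∈
      ... | inj₁ x∈i = x∈p⇒⁅x⁆⊆p (∈-tabulate⁺ (i Fin.≤?_) ℕ.≤-refl) x∈i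
      ... | inj₂ x∈J = J⊆ x∈J
      ∣V∣ : ∣ V ∣ ≡ suc ∣ J σ i ∣
      ∣V∣ = trans (sym (suc∣p-x∣≡∣p∣ (x∈p∪q⁺ (inj₁ (x∈⁅x⁆ i))))) (cong (λ (U : Subset n) → suc ∣ U ∣) V-i≡J)
        where
        V-i≡J : V Subset.- i ≡ J σ i
        V-i≡J = ⊆-antisym
          (λ x∈ → [ (λ x∈i → contradiction x∈ (x∈q⇒x∉p─q {p = V} x∈i)) , id ] (x∈p∪q⁻ ⁅ i ⁆ (J σ i) (p─q⊆p V ⁅ i ⁆ x∈)))
          (λ x∈J → x∈p∧x∉q⇒x∈p─q (x∈p∪q⁺ (inj₂ x∈J)) (λ x∈i → i∉J (subst (_∈ J σ i) (x∈⁅y⁆⇒x≡y _ x∈i) x∈J)))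
      to : ∀ {S} → i ∉ S × ¬ Nonempty (J σ i ∩ S) → ∀ x → x ∈ S → x ∉ V
      to (i∉S , empty) x x∈S x∈V with x∈p∪q⁻ ⁅ i ⁆ (J σ i) x∈V
      ... | inj₁ x∈i = i∉S (subst (_∈ _) (x∈⁅y⁆⇒x≡y _ x∈i) x∈S)
      ... | inj₂ x∈J = empty (x , x∈p∩q⁺ (x∈J , x∈S))
      from : ∀ {S} → (∀ x → x ∈ S → x ∉ V) → i ∉ S × ¬ Nonempty (J σ i ∩ S)
      from disj = (λ i∈S → disj i i∈S (x∈p∪q⁺ (inj₁ (x∈⁅x⁆ i)))) ,
        λ (x , x∈) → let x∈J , x∈S = x∈p∩q⁻ (J σ i) _ x∈ in disj x x∈S (x∈p∪q⁺ (inj₂ x∈J))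

    -- Double counting of the pairs (S , j) with j ∈ J(i) ∩ S: every j of J(i) lies in {i,...,n} and
    -- hence in equally many of the subsets.
    ∑∑-members-∩ : ∀ ℓ q →
      ∑ (subsetsFrom i (suc ℓ)) (λ S → ∑ (members (J σ i ∩ S)) (λ _ → q))
        ≡ fromℕ ∣ J σ i ∣ * (fromℕ ((n ∸ toℕ i ∸ 1) C ℓ) * q)
    ∑∑-members-∩ ℓ q = begin
      ∑ xs (λ S → ∑ (members (J σ i ∩ S)) (λ _ → q))
        ≡⟨ ∑-cong xs (λ S → ∑-members-∩ S) ⟩
      ∑ xs (λ S → ∑ (members (J σ i)) (λ j → 𝟙 (does (j ∈? S)) * q))
        ≡⟨ ∑-comm xs (members (J σ i)) (λ S j → 𝟙 (does (j ∈? S)) * q) ⟩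
      ∑ (members (J σ i)) (λ j → ∑ xs (λ S → 𝟙 (does (j ∈? S)) * q))
        ≡⟨ ∑-cong-All (All.map (λ j∈J → trans (*-distribʳ-∑ q xs _) (cong (_* q) (∑-∋ i ℓ (J⊆ j∈J)))) (All.all-filter (_∈? J σ i) (allFin n))) ⟩
      ∑ (members (J σ i)) (λ j → fromℕ ((n ∸ toℕ i ∸ 1) C ℓ) * q)
        ≡⟨ ∑-members-const (J σ i) _ ⟩
      fromℕ ∣ J σ i ∣ * (fromℕ ((n ∸ toℕ i ∸ 1) C ℓ) * q)
        ∎
      where
      xs = subsetsFrom i (suc ℓ)
      ∑-members-∩ : ∀ S → ∑ (members (J σ i ∩ S)) (λ _ → q) ≡ ∑ (members (J σ i)) (λ j → 𝟙 (does (j ∈? S)) * q)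
      ∑-members-∩ S = begin
        ∑ (members (J σ i ∩ S)) (λ _ → q)
          ≡⟨ ∑-members (J σ i ∩ S) _ ⟩
        ∑ (allFin n) (λ j → 𝟙 (does (j ∈? (J σ i ∩ S))) * q)
          ≡⟨ ∑-cong (allFin n) (λ j → trans (cong (_* q) (𝟙-∩ j)) (*-assoc (𝟙 (does (j ∈? J σ i))) (𝟙 (does (j ∈? S))) q)) ⟩
        ∑ (allFin n) (λ j → 𝟙 (does (j ∈? J σ i)) * (𝟙 (does (j ∈? S)) * q))
          ≡⟨ ∑-members (J σ i) _ ⟨
        ∑ (members (J σ i)) (λ j → 𝟙 (does (j ∈? S)) * q) ∎
        where
        𝟙-∩ : ∀ j → 𝟙 (does (j ∈? (J σ i ∩ S))) ≡ 𝟙 (does (j ∈? J σ i)) * 𝟙 (does (j ∈? S))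
        𝟙-∩ j = trans (cong 𝟙 (does-⇔ (mk⇔ (x∈p∩q⁻ (J σ i) S) x∈p∩q⁺) (j ∈? (J σ i ∩ S)) ((j ∈? J σ i) ×-dec (j ∈? S))))
          (𝟙-∧ (does (j ∈? J σ i)) (does (j ∈? S)))

    -- The square in α⁽¹⁾ comes from two independent events of probability ρ: i ∈ S, and the chosen
    -- one of the c_i + 1 points of {i} ∪ J(i) lying in S′. In α⁽⁰⁾ the factor γ is the probability
    -- that S′ avoids all those points, in which case all c_i + 1 calls are made at once.
    average-calls : ∀ {ℓ} → suc ℓ < n ∸ toℕ i →
      average (cartesianProduct (subsetsFrom i (suc ℓ)) (subsetsFrom i (suc ℓ))) (λ (S , S′) → ∑ (calls σ i S S′) cost)
        ≡ α σ true (label i) (+ suc ℓ) * (fromℕ (suc ∣ J σ i ∣) * E ℓ + fromℕ ∣ J σ i ∣ * fromℕ ℓ)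
          + α σ false (label i) (+ suc ℓ) * (fromℕ (suc ∣ J σ i ∣) * E (suc ℓ) + fromℕ ∣ J σ i ∣ * fromℕ (suc ℓ))
    average-calls {ℓ} ℓ<N = average-normalise xs {{L≢0}} _ _ (begin
      ∑ (cartesianProduct xs xs) (λ (S , S′) → ∑ (calls σ i S S′) cost)
        ≡⟨ ∑-cartesianProduct xs xs _ ⟩
      ∑ xs (λ S → ∑ xs (λ S′ → ∑ (calls σ i S S′) cost))
        ≡⟨ ∑-cong-All (All.map (λ ∣S∣ → ∑-cong-All (All.map (λ ∣S′∣ → ∑-calls (proj₂ ∣S∣) (proj₂ ∣S′∣)) xs-size)) xs-size) ⟩
      ∑ xs (λ S → ∑ xs (λ S′ → in′ S * f S′ + out S * g S′))
        ≡⟨ ∑-cong xs (λ S → ∑-distrib-+ xs (λ S′ → in′ S * f S′) (λ S′ → out S * g S′)) ⟩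
      ∑ xs (λ S → ∑ xs (λ S′ → in′ S * f S′) + ∑ xs (λ S′ → out S * g S′))
        ≡⟨ ∑-distrib-+ xs _ _ ⟩
      ∑ xs (λ S → ∑ xs (λ S′ → in′ S * f S′)) + ∑ xs (λ S → ∑ xs (λ S′ → out S * g S′))
        ≡⟨ cong₂ _+_ (∑-factor xs xs in′ f) (∑-factor xs xs out g) ⟩
      ∑ xs in′ * ∑ xs f + ∑ xs out * ∑ xs g
        ≡⟨ cong₂ _+_ (cong₂ _*_ ∑in ∑f) (cong₂ _*_ ∑out ∑g) ⟩
      r′ * L * (r′ * L * E ℓ + k * (r′ * L * (fromℕ ℓ + E ℓ))) + r̄ * L * (g′ * L * (E (suc ℓ) + k * (fromℕ (suc ℓ) + E (suc ℓ))))
        ≡⟨ average-numerator r′ r̄ g′ L k (E ℓ) (E (suc ℓ)) (fromℕ ℓ) (fromℕ (suc ℓ)) ⟩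
      (r′ * r′ * ((1ℚ + k) * E ℓ + k * fromℕ ℓ) + r̄ * g′ * ((1ℚ + k) * E (suc ℓ) + k * fromℕ (suc ℓ))) * (L * L)
        ≡⟨ cong (λ z → (r′ * r′ * (z * E ℓ + k * fromℕ ℓ) + r̄ * g′ * (z * E (suc ℓ) + k * fromℕ (suc ℓ))) * (L * L)) (fromℕ-homo-+ 1 ∣ J σ i ∣) ⟨
      (r′ * r′ * (fromℕ (suc ∣ J σ i ∣) * E ℓ + k * fromℕ ℓ) + r̄ * g′ * (fromℕ (suc ∣ J σ i ∣) * E (suc ℓ) + k * fromℕ (suc ℓ))) * (L * L) ∎)
      where
      xs = subsetsFrom i (suc ℓ)
      N′ = n ∸ toℕ i ∸ 1
      r′ = ρ σ (label i) (+ suc ℓ)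
      r̄ = ρ̄ σ (label i) (+ suc ℓ)
      g′ = γ σ (label i) (+ suc ℓ)
      L = fromℕ (length xs)
      k = fromℕ ∣ J σ i ∣
      in′ out f g : Subset n → ℚ
      in′ S = 𝟙 (does (i ∈? S))
      out S = 𝟙 (not (does (i ∈? S)))
      f S = 𝟙 (does (i ∈? S)) * E ℓ + ∑ (members (J σ i ∩ S)) (λ _ → fromℕ ℓ + E ℓ)
      g S = 𝟙 (does (disjoint? S)) * (E (suc ℓ) + k * (fromℕ (suc ℓ) + E (suc ℓ)))
      i∈ : i ∈ upFrom i
      i∈ = ∈-tabulate⁺ (i Fin.≤?_) ℕ.≤-refl
      N≡ : n ∸ toℕ i ≡ suc N′
      N≡ = sym (ℕ.m+[n∸m]≡n (ℕ.m<n⇒0<n∸m (Fin.toℕ<n i)))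
      L≡ : L ≡ fromℕ (suc N′ C suc ℓ)
      L≡ = cong fromℕ (trans (length-subsetsFrom i (suc ℓ)) (cong (_C suc ℓ) N≡))
      L≢0 : ℕ.NonZero (length xs)
      L≢0 = subst ℕ.NonZero (sym (length-subsetsFrom i (suc ℓ))) (nCk≢0 (ℕ.<⇒≤ ℓ<N))
      xs-size : All (λ S → S ⊆ upFrom i × ∣ S ∣ ≡ suc ℓ) xs
      xs-size = All.all-filter (_⊆[ suc ℓ ]? upFrom i) (subsets n)
      r′*L : r′ * L ≡ fromℕ (N′ C ℓ)
      r′*L = trans (cong₂ _*_ (trans (ρ-inner (s≤s z≤n) ℓ<N) (cong (suc ℓ ÷_) N≡)) L≡) ([k+1]÷[n+1]*[n+1]C[k+1]≡nCk N′ ℓ)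
      r̄*L : r̄ * L ≡ fromℕ (N′ C suc ℓ)
      r̄*L = trans (cong₂ _*_ (trans (ρ̄-inner (s≤s z≤n) ℓ<N) (cong (λ m → 1ℚ - (suc ℓ ÷ m)) N≡)) L≡) ([1-[k+1]÷[n+1]]*[n+1]C[k+1]≡nC[k+1] N′ ℓ)
      g′*L : g′ * L ≡ fromℕ ((n ∸ toℕ i ∸ suc ∣ J σ i ∣) C suc ℓ)
      g′*L = trans (cong (λ l → g′ * fromℕ l) (length-subsetsFrom i (suc ℓ))) (γ*nCℓ (ℕ.<⇒≤ ℓ<N))
      ∑in : ∑ xs in′ ≡ r′ * L
      ∑in = trans (∑-∋ i ℓ i∈) (sym r′*L)
      ∑out : ∑ xs out ≡ r̄ * L
      ∑out = trans (∑-∌ i (suc ℓ) i∈) (sym r̄*L)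
      ∑f : ∑ xs f ≡ r′ * L * E ℓ + k * (r′ * L * (fromℕ ℓ + E ℓ))
      ∑f = trans (∑-distrib-+ xs _ _) (cong₂ _+_
        (trans (*-distribʳ-∑ (E ℓ) xs in′) (cong (_* E ℓ) ∑in))
        (trans (∑∑-members-∩ ℓ (fromℕ ℓ + E ℓ)) (cong (λ z → k * (z * (fromℕ ℓ + E ℓ))) (sym r′*L))))
      ∑g : ∑ xs g ≡ g′ * L * (E (suc ℓ) + k * (fromℕ (suc ℓ) + E (suc ℓ)))
      ∑g = trans (*-distribʳ-∑ _ xs _) (cong (_* (E (suc ℓ) + k * (fromℕ (suc ℓ) + E (suc ℓ)))) (trans (∑-disjoint (suc ℓ)) (sym g′*L)))

-- The order of the group

enumerate : (S : Subset n) → Fin ∣ S ∣ → Fin n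
enumerate (outside ∷ S) a       = suc (enumerate S a)
enumerate (inside  ∷ S) zero    = zero
enumerate (inside  ∷ S) (suc a) = suc (enumerate S a)

enumerate-∈ : ∀ (S : Subset n) a → enumerate S a ∈ S
enumerate-∈ (outside ∷ S) a       = there (enumerate-∈ S a)
enumerate-∈ (inside  ∷ S) zero    = here
enumerate-∈ (inside  ∷ S) (suc a) = there (enumerate-∈ S a)

enumerate-injective : ∀ (S : Subset n) {a b} → enumerate S a ≡ enumerate S b → a ≡ b
enumerate-injective (outside ∷ S)                 eq = enumerate-injective S (Fin.suc-injective eq)
enumerate-injective (inside  ∷ S) {zero}  {zero}  eq = refl
enumerate-injective (inside  ∷ S) {suc a} {suc b} eq = cong suc (enumerate-injective S (Fin.suc-injective eq))

enumerate-surjective : ∀ {S : Subset n} {x} → x ∈ S → ∃ λ a → enumerate S a ≡ x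
enumerate-surjective {S = inside  ∷ S} here = zero , refl
enumerate-surjective {S = inside  ∷ S} (there x∈S) with a , eq ← enumerate-surjective x∈S = suc a , cong suc eq
enumerate-surjective {S = outside ∷ S} (there x∈S) with a , eq ← enumerate-surjective x∈S = a , cong suc eq

⟨$⟩ʳ-injective : ∀ (π : Permutation′ n) {x y} → π ⟨$⟩ʳ x ≡ π ⟨$⟩ʳ y → x ≡ y
⟨$⟩ʳ-injective π eq = trans (sym (inverseˡ π)) (trans (cong (π ⟨$⟩ˡ_) eq) (inverseˡ π))

⟨$⟩ʳ⇒⟨$⟩ˡ : ∀ (π : Permutation′ n) {x y} → π ⟨$⟩ʳ x ≡ y → π ⟨$⟩ˡ y ≡ x
⟨$⟩ʳ⇒⟨$⟩ˡ π eq = trans (cong (π ⟨$⟩ˡ_) (sym eq)) (inverseˡ π)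

-- Enumerating both groups turns the inclusion into an injection between finite sets. Applied in
-- both directions, it shows that the order of a group is unique.
order-mono : ∀ {G : Pred (Permutation′ n) ℓ₂} {H : Pred (Permutation′ n) ℓ₃} {a b} →
             (∀ {π} → G π → H π) → HasOrder G a → HasOrder H b → a ≤ b
order-mono {G = G} {H} {a} {b} G⊆H A B = Fin.injective⇒≤ {f = index} (λ {x} {y} eq →
  A.injective (λ t → trans (sym (index-correct x t)) (trans (cong (λ z → proj₁ (B.to z) ⟨$⟩ʳ t) eq) (index-correct y t))))
  where
  module A = Bijection A
  module B = Bijection B
  embed : Fin a → ∃ H
  embed x = proj₁ (A.to x) , G⊆H (proj₂ (A.to x))
  index : Fin a → Fin b
  index x = proj₁ (B.surjective (embed x))
  index-correct : ∀ x t → proj₁ (B.to (index x)) ⟨$⟩ʳ t ≡ proj₁ (A.to x) ⟨$⟩ʳ t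
  index-correct x = proj₂ (B.surjective (embed x)) refl

Stabiliser : Pred (Permutation′ n) ℓ₂ → ℕ → Pred (Permutation′ n) ℓ₂
Stabiliser G i π = G π × (∀ t → toℕ t < i → π ⟨$⟩ʳ t ≡ t)

r≤n : ∀ (σ : Table n) → r σ ≤ n
r≤n σ = max≤v⁺ z≤n (All.map⁺ {xs = filter (λ i → nonempty? (J σ i)) (allFin _)} (All.tabulate λ {x} _ → Fin.toℕ<n x))

r≤x⇒J-empty : ∀ (σ : Table n) x → r σ ≤ toℕ x → ¬ Nonempty (J σ x)
r≤x⇒J-empty σ x r≤x Jx = ℕ.<⇒≱ (All.lookup (xs≤max 0 (map label (filter (λ i → nonempty? (J σ i)) (allFin _))))
  (∈-map⁺ label (∈-filter⁺ (λ i → nonempty? (J σ i)) (∈-allFin x) Jx))) r≤x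

module _ {G : Pred (Permutation′ n) ℓ₂} (isSubgroup : IsSubgroup G) {σ : Table n} (isSwitchTable : IsSwitchTable G σ) where
  open IsSubgroup isSubgroup
  open IsSwitchTable isSwitchTable

  ∈J⇒≉id : ∀ {i j} → j ∈ J σ i → ¬ (σ i j Perm.≈ Perm.id)
  ∈J⇒≉id {i} = ∈-tabulate⁻ (λ j → ¬? (σ i j ≈? Perm.id))

  -- `G` is an arbitrary predicate, so the existence of a switch need not be decidable. The
  -- conclusions here and in the next two lemmas are decidable, hence may be refuted: if one failed,
  -- no switch could exist and `otherwise` would make the entry trivial.
  ∈J⇒< : ∀ {i j} → j ∈ J σ i → i Fin.< j
  ∈J⇒< {i} {j} j∈J = decidable-stable (i Fin.<? j) λ i≮j →
    ∈J⇒≉id j∈J (otherwise (i≮j ∘ proj₁))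

  ∈J⇒moves : ∀ {i j} → j ∈ J σ i → σ i j ⟨$⟩ʳ j ≡ i
  ∈J⇒moves {i} {j} j∈J = decidable-stable (_ Fin.≟ i) λ σj≢i →
    ∈J⇒≉id j∈J (otherwise λ (i<j , s) → σj≢i (Switches.moves (switch i<j s)))

  ∈J⇒fixes : ∀ {i j} → j ∈ J σ i → ∀ t → t Fin.< i → σ i j ⟨$⟩ʳ t ≡ t
  ∈J⇒fixes {i} {j} j∈J t t<i = decidable-stable (_ Fin.≟ t) λ σt≢t →
    ∈J⇒≉id j∈J (otherwise λ (i<j , s) → σt≢t (Switches.fixes (switch i<j s) t t<i))

  J⊆upFrom : ∀ i → J σ i ⊆ upFrom i
  J⊆upFrom i j∈J = ∈-tabulate⁺ (i Fin.≤?_) (ℕ.<⇒≤ (∈J⇒< j∈J))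

  i∉Ji : ∀ i → i ∉ J σ i
  i∉Ji i i∈J = ℕ.<-irrefl refl (∈J⇒< i∈J)

  preimage : ∀ {π} i → Stabiliser G (toℕ i) π → π ⟨$⟩ˡ i ≡ i ⊎ π ⟨$⟩ˡ i ∈ J σ i
  preimage {π} i (π∈G , fix) with Fin.<-cmp (π ⟨$⟩ˡ i) i
  ... | tri≈ _ j≡i _ = inj₁ j≡i
  ... | tri< j<i _ _ = inj₁ (trans (sym (fix _ j<i)) (inverseʳ π))
  ... | tri> _ j≢i i<j = inj₂ (∈-tabulate⁺ (λ j → ¬? (σ i j ≈? Perm.id)) λ σ≈id → j≢i
    (trans (sym (σ≈id (π ⟨$⟩ˡ i))) (Switches.moves (switch i<j
      (π , record { member = π∈G ; moves = inverseʳ π ; fixes = fix })))))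

  -- Strong induction on the points: once all points below x are fixed, `preimage` leaves x as its
  -- own preimage or a non-trivial entry in row x, and there is none for x past the last effective
  -- row.
  order-r : HasOrder (Stabiliser G (r σ)) 1
  order-r = record
    { to        = λ _ → Perm.id , id-closed , λ _ _ → refl
    ; cong      = λ _ _ → refl
    ; bijective = (λ { {zero} {zero} _ → refl }) , λ (π , π∈) → zero , λ _ x → sym (trivial π π∈ _ x refl)
    }
    where
    trivial : ∀ π → Stabiliser G (r σ) π → ∀ k x → toℕ x ≡ k → π ⟨$⟩ʳ x ≡ x
    trivial π (π∈G , fix) = <-rec _ step
      where
      step : ∀ k → (∀ {l} → l < k → ∀ x → toℕ x ≡ l → π ⟨$⟩ʳ x ≡ x) → ∀ x → toℕ x ≡ k → π ⟨$⟩ʳ x ≡ x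
      step k rec x refl with toℕ x ℕ.<? r σ | preimage {π} x (π∈G , λ t t<x → rec t<x t refl)
      ... | yes x<r | _        = fix x x<r
      ... | no  x≮r | inj₁ eq  = trans (cong (π ⟨$⟩ʳ_) (sym eq)) (inverseʳ π)
      ... | no  x≮r | inj₂ j∈J = contradiction (_ , j∈J) (r≤x⇒J-empty σ x (ℕ.≮⇒≥ x≮r))

  module _ (i : Fin n) where

    -- A transversal of the stabiliser of {0,…,i} in the stabiliser of {0,…,i-1}:
    -- rep a maps source a to i.
    source : Fin (suc ∣ J σ i ∣) → Fin n
    source zero    = i
    source (suc a) = enumerate (J σ i) a

    rep : Fin (suc ∣ J σ i ∣) → Permutation′ n
    rep zero    = Perm.id
    rep (suc a) = σ i (source (suc a))

    source-injective : ∀ {a b} → source a ≡ source b → a ≡ b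
    source-injective {zero}  {zero}  eq = refl
    source-injective {zero}  {suc b} eq = contradiction (subst (_∈ J σ i) (sym eq) (enumerate-∈ (J σ i) b)) (i∉Ji i)
    source-injective {suc a} {zero}  eq = contradiction (subst (_∈ J σ i) eq (enumerate-∈ (J σ i) a)) (i∉Ji i)
    source-injective {suc a} {suc b} eq = cong suc (enumerate-injective (J σ i) eq)

    rep-source : ∀ a → rep a ⟨$⟩ʳ source a ≡ i
    rep-source zero    = refl
    rep-source (suc a) = ∈J⇒moves (enumerate-∈ (J σ i) a)

    rep-∈ : ∀ a → G (rep a)
    rep-∈ zero    = id-closed
    rep-∈ (suc a) = member i _

    rep-fixes : ∀ a t → t Fin.< i → rep a ⟨$⟩ʳ t ≡ t
    rep-fixes zero    t t<i = refl
    rep-fixes (suc a) t t<i = ∈J⇒fixes (enumerate-∈ (J σ i) a) t t<i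

    source-surjective : ∀ {π} → Stabiliser G (toℕ i) π → ∃ λ a → source a ≡ π ⟨$⟩ˡ i
    source-surjective {π} π∈ with preimage {π} i π∈
    ... | inj₁ eq  = zero , sym eq
    ... | inj₂ j∈J with a , eq ← enumerate-surjective j∈J = suc a , eq

    -- Every element factors uniquely through the transversal: the index `a` is recovered from the
    -- preimage of i, and what remains lies in the next stabiliser.
    order-step : ∀ {b} → HasOrder (Stabiliser G (suc (toℕ i))) b →
                 HasOrder (Stabiliser G (toℕ i)) (suc ∣ J σ i ∣ ℕ.* b)
    order-step {b} B = record
      { to        = λ z → to (Fin.remQuot b z)
      ; cong      = λ { refl _ → refl }
      ; bijective = (λ {z} {z′} → injective z z′) , surjective
      }
      where
      module B = Bijection B
      to : Fin (suc ∣ J σ i ∣) × Fin b → ∃ (Stabiliser G (toℕ i))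
      -- `∘ₚ` applies its left factor first: `rep a` takes `source a` to i, where π leaves it. The
      -- preimage of i under the product is thus `source a`.
      to (a , y) with π , π∈G , fix ← B.to y = rep a ∘ₚ π , ∘-closed (rep-∈ a) π∈G ,
        λ t t<i → trans (cong (π ⟨$⟩ʳ_) (rep-fixes a t t<i)) (fix t (ℕ.m<n⇒m<1+n t<i))

      injective′ : ∀ a y a′ y′ → (∀ t → proj₁ (to (a , y)) ⟨$⟩ʳ t ≡ proj₁ (to (a′ , y′)) ⟨$⟩ʳ t) → (a , y) ≡ (a′ , y′)
      injective′ a y a′ y′ eq = cong₂ _,_ a≡a′ (B.injective λ t → begin
        π ⟨$⟩ʳ t                                   ≡⟨ cong (π ⟨$⟩ʳ_) (inverseʳ (rep a)) ⟨
        π ⟨$⟩ʳ (rep a ⟨$⟩ʳ (rep a ⟨$⟩ˡ t))         ≡⟨ eq (rep a ⟨$⟩ˡ t) ⟩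
        π′ ⟨$⟩ʳ (rep a′ ⟨$⟩ʳ (rep a ⟨$⟩ˡ t))       ≡⟨ cong (λ a → π′ ⟨$⟩ʳ (rep a ⟨$⟩ʳ _)) a≡a′ ⟨
        π′ ⟨$⟩ʳ (rep a ⟨$⟩ʳ (rep a ⟨$⟩ˡ t))        ≡⟨ cong (π′ ⟨$⟩ʳ_) (inverseʳ (rep a)) ⟩
        π′ ⟨$⟩ʳ t                                  ∎)
        where
        π π′ : Permutation′ n
        π  = proj₁ (B.to y)
        π′ = proj₁ (B.to y′)
        a≡a′ : a ≡ a′
        a≡a′ = source-injective (⟨$⟩ʳ-injective (rep a′) (⟨$⟩ʳ-injective π′ (begin
          π′ ⟨$⟩ʳ (rep a′ ⟨$⟩ʳ source a)   ≡⟨ eq (source a) ⟨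
          π ⟨$⟩ʳ (rep a ⟨$⟩ʳ source a)     ≡⟨ cong (π ⟨$⟩ʳ_) (rep-source a) ⟩
          π ⟨$⟩ʳ i                         ≡⟨ proj₂ (proj₂ (B.to y)) i ℕ.≤-refl ⟩
          i                                ≡⟨ proj₂ (proj₂ (B.to y′)) i ℕ.≤-refl ⟨
          π′ ⟨$⟩ʳ i                        ≡⟨ cong (π′ ⟨$⟩ʳ_) (rep-source a′) ⟨
          π′ ⟨$⟩ʳ (rep a′ ⟨$⟩ʳ source a′)  ∎)))

      injective : ∀ z z′ → (∀ t → proj₁ (to (Fin.remQuot b z)) ⟨$⟩ʳ t ≡ proj₁ (to (Fin.remQuot b z′)) ⟨$⟩ʳ t) → z ≡ z′
      injective z z′ eq = trans (sym (Fin.combine-remQuot {suc ∣ J σ i ∣} b z))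
        (trans (cong (λ (a , y) → Fin.combine a y)
                 (injective′ (proj₁ (split z)) (proj₂ (split z)) (proj₁ (split z′)) (proj₂ (split z′)) eq))
               (Fin.combine-remQuot {suc ∣ J σ i ∣} b z′))
        where split = Fin.remQuot {suc ∣ J σ i ∣} b

      surjective : ∀ ((π , _) : ∃ (Stabiliser G (toℕ i))) →
        ∃ λ z → ∀ {z′} → z′ ≡ z → ∀ t → proj₁ (to (Fin.remQuot b z′)) ⟨$⟩ʳ t ≡ π ⟨$⟩ʳ t
      surjective (π , π∈@(π∈G , fix)) = Fin.combine a y , λ { refl t → begin
        proj₁ (to (Fin.remQuot b (Fin.combine a y))) ⟨$⟩ʳ t   ≡⟨ cong (λ ay → proj₁ (to ay) ⟨$⟩ʳ t) (Fin.remQuot-combine a y) ⟩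
        proj₁ (B.to y) ⟨$⟩ʳ (rep a ⟨$⟩ʳ t)            ≡⟨ proj₂ (B.surjective quotient) refl (rep a ⟨$⟩ʳ t) ⟩
        π ⟨$⟩ʳ (rep a ⟨$⟩ˡ (rep a ⟨$⟩ʳ t))            ≡⟨ cong (π ⟨$⟩ʳ_) (inverseˡ (rep a)) ⟩
        π ⟨$⟩ʳ t                                      ∎ }
        where
        -- Chosen so that `rep a` and π send the same point to i; then the inverse of `rep a`
        -- followed by π fixes i too.
        a = proj₁ (source-surjective {π} π∈)
        quotient-fixes : ∀ t → toℕ t < suc (toℕ i) → π ⟨$⟩ʳ (rep a ⟨$⟩ˡ t) ≡ t
        quotient-fixes t (s≤s t≤i) with Fin.<-cmp t i
        ... | tri< t<i _ _ = trans (cong (π ⟨$⟩ʳ_) (⟨$⟩ʳ⇒⟨$⟩ˡ (rep a) (rep-fixes a t t<i))) (fix t t<i)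
        ... | tri> _ _ i<t = contradiction t≤i (ℕ.<⇒≱ i<t)
        ... | tri≈ _ refl _ = begin
          π ⟨$⟩ʳ (rep a ⟨$⟩ˡ i)  ≡⟨ cong (π ⟨$⟩ʳ_) (⟨$⟩ʳ⇒⟨$⟩ˡ (rep a) (rep-source a)) ⟩
          π ⟨$⟩ʳ source a        ≡⟨ cong (π ⟨$⟩ʳ_) (proj₂ (source-surjective {π} π∈)) ⟩
          π ⟨$⟩ʳ (π ⟨$⟩ˡ i)      ≡⟨ inverseʳ π ⟩
          i                      ∎
        quotient : ∃ (Stabiliser G (suc (toℕ i)))
        quotient = Perm.flip (rep a) ∘ₚ π , ∘-closed (⁻¹-closed (rep-∈ a)) π∈G , quotient-fixes
        y = proj₁ (B.surjective quotient)

-- Branch weights and the recursion over the rows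

∏-cong : ∀ {A : Set} (xs : List A) {f g : A → ℚ} → (∀ x → f x ≡ g x) → ∏ xs f ≡ ∏ xs g
∏-cong []       eq = refl
∏-cong (x ∷ xs) eq = cong₂ _*_ (eq x) (∏-cong xs eq)

∏-allFin : ∀ n (f : Fin (suc n) → ℚ) → ∏ (allFin (suc n)) f ≡ f zero * ∏ (allFin n) (f ∘ suc)
∏-allFin n f = cong (λ q → f zero * q) (begin
  ∏ (List.tabulate suc) f          ≡⟨ cong (foldr _*_ 1ℚ) (List.map-tabulate suc f) ⟩
  foldr _*_ 1ℚ (List.tabulate (f ∘ suc))  ≡⟨ cong (foldr _*_ 1ℚ) (List.map-tabulate id (f ∘ suc)) ⟨
  ∏ (allFin n) (f ∘ suc)      ∎)

∑-upTo : ∀ p (f : ℕ → ℚ) → ∑ (upTo (suc p)) f ≡ f 0 + ∑ (upTo p) (f ∘ suc)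
∑-upTo p f = +-congˡ (f 0) (trans (cong (λ xs → ∑ xs f) (sym (List.map-upTo suc p))) (∑-map suc (upTo p) f))

m-[1+n]≡m-1-n : ∀ m n → m ℤ.- + suc n ≡ m ℤ.- + 1 ℤ.- + n
m-[1+n]≡m-1-n m n = trans (cong (λ z → m ℤ.+ z) (ℤ.neg-distrib-+ (+ 1) (+ n))) (sym (ℤ.+-assoc m (ℤ.- + 1) (ℤ.- + n)))

module _ (σ : Table n) where

  w-∷ : ∀ i ℓ x (b : Vec Bool p) → w σ i ℓ (x ∷ b) ≡ α σ x i ℓ * w σ (suc i) (if x then ℓ ℤ.- + 1 else ℓ) b
  w-∷ {p} i ℓ x b = trans (∏-allFin p (λ t → α σ (lookup (x ∷ b) t) (i ℕ.+ toℕ t) (ℓ ℤ.- + onesBefore σ (x ∷ b) t)))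
    (cong₂ _*_
      (cong₂ (α σ x) (ℕ.+-identityʳ i) (ℤ.+-identityʳ ℓ))
      (∏-cong (allFin p) λ t → cong₂ (α σ (lookup b t)) (ℕ.+-suc i (toℕ t)) (shift x t)))
    where
    shift : ∀ x t → ℓ ℤ.- + onesBefore σ (x ∷ b) (suc t) ≡ (if x then ℓ ℤ.- + 1 else ℓ) ℤ.- + onesBefore σ b t
    shift true  t = m-[1+n]≡m-1-n ℓ (onesBefore σ b t)
    shift false t = refl

  -- The bracketed sum of the formula over B_p, started at any level i and not only at 1, so that
  -- splitting off the first branch yields sums of the same kind. The cardinality is an integer
  -- because ℓ - 1 may be negative along a branch of weight 0.
  W : ℕ → ℕ → ℤ → ℚ
  W p i ℓ = ∑[ b ∈ subsets p ] (w σ i ℓ b * ν σ ℓ b)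

  W-zero : ∀ i ℓ → W 0 i (+ ℓ) ≡ fromℕ ℓ
  W-zero i ℓ = begin
    1ℚ * ν σ (+ ℓ) [] + 0ℚ  ≡⟨ +-identityʳ _ ⟩
    1ℚ * ν σ (+ ℓ) []       ≡⟨ *-identityˡ _ ⟩
    ν σ (+ ℓ) []            ≡⟨ cong (λ k → k ℚ./ 1) (trans (cong (λ k → k ℤ.⊔ + 0) (ℤ.+-identityʳ (+ ℓ))) (cong (λ k → + k) (ℕ.⊔-identityʳ ℓ))) ⟩
    fromℕ ℓ                 ∎

  W-suc : ∀ p i ℓ → W (suc p) i ℓ ≡ α σ true i ℓ * W p (suc i) (ℓ ℤ.- + 1) + α σ false i ℓ * W p (suc i) ℓ
  W-suc p i ℓ = begin
    W (suc p) i ℓ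
      ≡⟨ ∑-subsets p (λ b → w σ i ℓ b * ν σ ℓ b) ⟩
    ∑ (subsets p) (λ b → w σ i ℓ (false ∷ b) * ν σ ℓ b) + ∑ (subsets p) (λ b → w σ i ℓ (true ∷ b) * ν σ ℓ (true ∷ b))
      ≡⟨ cong₂ _+_ (branch false λ _ → refl) (branch true λ b → cong (λ k → (k ℤ.⊔ + 0) ℚ./ 1) (m-[1+n]≡m-1-n ℓ ∣ b ∣)) ⟩
    α σ false i ℓ * W p (suc i) ℓ + α σ true i ℓ * W p (suc i) (ℓ ℤ.- + 1)
      ≡⟨ +-comm (α σ false i ℓ * W p (suc i) ℓ) _ ⟩
    α σ true i ℓ * W p (suc i) (ℓ ℤ.- + 1) + α σ false i ℓ * W p (suc i) ℓ ∎
    where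
    branch : ∀ x → (let ℓ′ = if x then ℓ ℤ.- + 1 else ℓ) → (∀ (b : Vec Bool p) → ν σ ℓ (x ∷ b) ≡ ν σ ℓ′ b) →
      ∑ (subsets p) (λ b → w σ i ℓ (x ∷ b) * ν σ ℓ (x ∷ b)) ≡ α σ x i ℓ * W p (suc i) ℓ′
    branch x ν≡ = trans
      (∑-cong (subsets p) λ b → trans (cong₂ _*_ (w-∷ i ℓ x b) (ν≡ b)) (*-assoc (α σ x i ℓ) _ _))
      (*-distribˡ-∑ (α σ x i ℓ) (subsets p) _)

  -- The conventions ρ = ρ̄ = 0 kill both first factors, in agreement with the early returns. At
  -- least one row must be left: at level r + 1 the comparison is charged for a full set as well.
  W-boundary : ∀ p i ℓ → ¬ (0 < ℓ × ℓ < size σ i) → W (suc p) i (+ ℓ) ≡ 0ℚ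
  W-boundary p i ℓ out = begin
    W (suc p) i (+ ℓ)
      ≡⟨ W-suc p i (+ ℓ) ⟩
    ρ σ i (+ ℓ) * ρ σ i (+ ℓ) * x + ρ̄ σ i (+ ℓ) * γ σ i (+ ℓ) * y
      ≡⟨ cong₂ (λ u v → u * u * x + v * γ σ i (+ ℓ) * y)
           (cong (λ b → if b then ℓ ÷ size σ i else 0ℚ) (⌊⌋-false inner? out))
           (cong (λ b → if b then 1ℚ - (ℓ ÷ size σ i) else 0ℚ) (⌊⌋-false inner? out)) ⟩
    0ℚ * 0ℚ * x + 0ℚ * γ σ i (+ ℓ) * y
      ≡⟨ cong₂ _+_ (trans (*-assoc 0ℚ 0ℚ x) (*-zeroˡ (0ℚ * x))) (trans (*-assoc 0ℚ (γ σ i (+ ℓ)) y) (*-zeroˡ (γ σ i (+ ℓ) * y))) ⟩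
    0ℚ ∎
    where
    inner? = (0 ℕ.<? ℓ) ×-dec (ℓ ℕ.<? size σ i)
    x = W p (suc i) (+ ℓ ℤ.- + 1)
    y = W p (suc i) (+ ℓ)

  -- The product of c + 1 over p consecutive rows from row i on. Unlike κ it also expresses the
  -- initial products ∏_{t<j} (c_t + 1), and it unfolds along with the rows.
  K : ℕ → ℕ → ℕ
  K zero    i = 1
  K (suc p) i = suc (c σ i) ℕ.* K p (suc i)

  K-+ : ∀ p q i → K (p ℕ.+ q) i ≡ K p i ℕ.* K q (i ℕ.+ p)
  K-+ zero    q i = trans (cong (K q) (sym (ℕ.+-identityʳ i))) (sym (ℕ.+-identityʳ _))
  K-+ (suc p) q i = trans
    (cong (suc (c σ i) ℕ.*_) (trans (K-+ p q (suc i)) (cong (λ j → K p (suc i) ℕ.* K q j) (sym (ℕ.+-suc i p)))))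
    (sym (ℕ.*-assoc (suc (c σ i)) (K p (suc i)) (K q (i ℕ.+ suc p))))

  K≢0 : ∀ p i → ℕ.NonZero (K p i)
  K≢0 zero    i = _
  K≢0 (suc p) i = ℕ.m*n≢0 (suc (c σ i)) (K p (suc i)) {{_}} {{K≢0 p (suc i)}}

  κ≡K : ∀ i → κ σ i ≡ K (suc (r σ) ∸ i) i
  κ≡K i = product-K (suc (r σ) ∸ i) i (i ℕ.+_) (λ _ → refl)
    where
    -- `applyUpTo` recurs on `f ∘ suc`, so the induction is over all functions with the values of
    -- `i ℕ.+_`.
    product-K : ∀ p i f → (∀ j → f j ≡ i ℕ.+ j) → product (map (λ j → suc (c σ j)) (applyUpTo f p)) ≡ K p i
    product-K zero    i f f≡ = refl
    product-K (suc p) i f f≡ = cong₂ (λ x y → suc (c σ x) ℕ.* y) (trans (f≡ 0) (ℕ.+-identityʳ i))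
      (product-K p (suc i) (f ∘ suc) (λ j → trans (f≡ (suc j)) (ℕ.+-suc i j)))

  -- Contribution to the total cost of the images computed in row i + j.
  switching : ℕ → ℤ → ℕ → ℚ
  switching i ℓ j = W (suc j) i ℓ * fromℕ (c σ (i ℕ.+ j)) * fromℕ (K j i)

  -- The right-hand side of the formula for p rows starting at row i, free of division: comparisons
  -- after the last row plus the images of each row.
  total : ℕ → ℕ → ℤ → ℚ
  total p i ℓ = W p i ℓ * fromℕ (K p i) + ∑ (upTo p) (switching i ℓ)

  total-zero : ∀ i ℓ → total 0 i (+ ℓ) ≡ fromℕ ℓ
  total-zero i ℓ = trans (+-identityʳ _) (trans (*-identityʳ _) (W-zero i ℓ))

  -- The recursion of `average-calls`. The comparisons and the images of later rows carry a factor
  -- c_i + 1 from the first row of `K`; the images of row i itself are the separate terms with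
  -- `c σ i`.
  total-suc : ∀ p i ℓ → total (suc p) i (+ suc ℓ)
    ≡ α σ true i (+ suc ℓ) * (fromℕ (suc (c σ i)) * total p (suc i) (+ ℓ) + fromℕ (c σ i) * fromℕ ℓ)
      + α σ false i (+ suc ℓ) * (fromℕ (suc (c σ i)) * total p (suc i) (+ suc ℓ) + fromℕ (c σ i) * fromℕ (suc ℓ))
  total-suc p i ℓ = begin
    W (suc p) i (+ suc ℓ) * fromℕ (K (suc p) i) + ∑ (upTo (suc p)) (switching i (+ suc ℓ))
      ≡⟨ cong₂ _+_
           (trans (cong₂ _*_ (W-suc p i (+ suc ℓ)) (fromℕ-homo-* (suc (c σ i)) (K p (suc i)))) (distrib a₁ a₀ u₁ u₀ s k))
           (trans (∑-upTo p (switching i (+ suc ℓ))) (cong₂ _+_ first rest)) ⟩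
    (a₁ * (s * (u₁ * k)) + a₀ * (s * (u₀ * k)))
      + ((a₁ * (c′ * fromℕ ℓ) + a₀ * (c′ * fromℕ (suc ℓ))) + (a₁ * (s * t₁) + a₀ * (s * t₀)))
      ≡⟨ merge a₁ a₀ s (u₁ * k) (u₀ * k) (c′ * fromℕ ℓ) (c′ * fromℕ (suc ℓ)) t₁ t₀ ⟩
    a₁ * (s * (u₁ * k + t₁) + c′ * fromℕ ℓ) + a₀ * (s * (u₀ * k + t₀) + c′ * fromℕ (suc ℓ)) ∎
    where
    a₁ = α σ true i (+ suc ℓ)
    a₀ = α σ false i (+ suc ℓ)
    s = fromℕ (suc (c σ i))
    c′ = fromℕ (c σ i)
    k = fromℕ (K p (suc i))
    u₁ = W p (suc i) (+ ℓ)
    u₀ = W p (suc i) (+ suc ℓ)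
    t₁ = ∑ (upTo p) (switching (suc i) (+ ℓ))
    t₀ = ∑ (upTo p) (switching (suc i) (+ suc ℓ))

    distrib : ∀ a₁ a₀ u₁ u₀ s k → (a₁ * u₁ + a₀ * u₀) * (s * k) ≡ a₁ * (s * (u₁ * k)) + a₀ * (s * (u₀ * k))
    distrib a₁ a₀ u₁ u₀ s k = trans (*-distribʳ-+ (s * k) (a₁ * u₁) (a₀ * u₀)) (cong₂ _+_ (swap a₁ u₁) (swap a₀ u₀))
      where
      swap : ∀ a u → a * u * (s * k) ≡ a * (s * (u * k))
      swap a u = solve 4 (λ a u s k → a :* u :* (s :* k) := a :* (s :* (u :* k))) refl a u s k

    merge : ∀ a₁ a₀ s x₁ x₀ y₁ y₀ t₁ t₀ →
      (a₁ * (s * x₁) + a₀ * (s * x₀)) + ((a₁ * y₁ + a₀ * y₀) + (a₁ * (s * t₁) + a₀ * (s * t₀)))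
      ≡ a₁ * (s * (x₁ + t₁) + y₁) + a₀ * (s * (x₀ + t₀) + y₀)
    merge a₁ a₀ s x₁ x₀ y₁ y₀ t₁ t₀ = trans
      (solve 6 (λ A B C D E F → (A :+ B) :+ ((C :+ D) :+ (E :+ F)) := (A :+ C :+ E) :+ (B :+ D :+ F)) refl
        (a₁ * (s * x₁)) (a₀ * (s * x₀)) (a₁ * y₁) (a₀ * y₀) (a₁ * (s * t₁)) (a₀ * (s * t₀)))
      (cong₂ _+_ (one a₁ x₁ y₁ t₁) (one a₀ x₀ y₀ t₀))
      where
      one : ∀ a x y t → a * (s * x) + a * y + a * (s * t) ≡ a * (s * (x + t) + y)
      one a x y t = solve 5 (λ a x y t s → a :* (s :* x) :+ a :* y :+ a :* (s :* t) := a :* (s :* (x :+ t) :+ y)) refl a x y t s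

    -- Row i has no rows before it, so its product `K 0 i` is 1, and after one branch ν is ℓ or ℓ +
    -- 1, exactly the price of an image there.
    first : switching i (+ suc ℓ) 0 ≡ a₁ * (c′ * fromℕ ℓ) + a₀ * (c′ * fromℕ (suc ℓ))
    first = begin
      W 1 i (+ suc ℓ) * fromℕ (c σ (i ℕ.+ 0)) * 1ℚ
        ≡⟨ *-identityʳ _ ⟩
      W 1 i (+ suc ℓ) * fromℕ (c σ (i ℕ.+ 0))
        ≡⟨ cong₂ _*_ (trans (W-suc 0 i (+ suc ℓ)) (cong₂ (λ x y → a₁ * x + a₀ * y) (W-zero (suc i) ℓ) (W-zero (suc i) (suc ℓ)))) (cong (fromℕ ∘ c σ) (ℕ.+-identityʳ i)) ⟩
      (a₁ * fromℕ ℓ + a₀ * fromℕ (suc ℓ)) * c′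
        ≡⟨ solve 5 (λ a b x y c → (a :* x :+ b :* y) :* c := a :* (c :* x) :+ b :* (c :* y)) refl a₁ a₀ (fromℕ ℓ) (fromℕ (suc ℓ)) c′ ⟩
      a₁ * (c′ * fromℕ ℓ) + a₀ * (c′ * fromℕ (suc ℓ)) ∎

    rest : ∑ (upTo p) (switching i (+ suc ℓ) ∘ suc) ≡ a₁ * (s * t₁) + a₀ * (s * t₀)
    rest = begin
      ∑ (upTo p) (switching i (+ suc ℓ) ∘ suc)
        ≡⟨ ∑-cong (upTo p) step ⟩
      ∑ (upTo p) (λ j → a₁ * (s * switching (suc i) (+ ℓ) j) + a₀ * (s * switching (suc i) (+ suc ℓ) j))
        ≡⟨ ∑-distrib-+ (upTo p) _ _ ⟩
      ∑ (upTo p) (λ j → a₁ * (s * switching (suc i) (+ ℓ) j)) + ∑ (upTo p) (λ j → a₀ * (s * switching (suc i) (+ suc ℓ) j))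
        ≡⟨ cong₂ _+_ (pull a₁ (switching (suc i) (+ ℓ))) (pull a₀ (switching (suc i) (+ suc ℓ))) ⟩
      a₁ * (s * t₁) + a₀ * (s * t₀) ∎
      where
      pull : ∀ a f → ∑ (upTo p) (λ j → a * (s * f j)) ≡ a * (s * ∑ (upTo p) f)
      pull a f = trans (*-distribˡ-∑ a (upTo p) _) (cong (λ q → a * q) (*-distribˡ-∑ s (upTo p) f))
      step : ∀ j → switching i (+ suc ℓ) (suc j) ≡ a₁ * (s * switching (suc i) (+ ℓ) j) + a₀ * (s * switching (suc i) (+ suc ℓ) j)
      step j = begin
        W (suc (suc j)) i (+ suc ℓ) * fromℕ (c σ (i ℕ.+ suc j)) * fromℕ (K (suc j) i)
          ≡⟨ cong₂ _*_ (cong₂ _*_ (W-suc (suc j) i (+ suc ℓ)) (cong (fromℕ ∘ c σ) (ℕ.+-suc i j))) (fromℕ-homo-* (suc (c σ i)) (K j (suc i))) ⟩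
        (a₁ * v₁ + a₀ * v₀) * d * (s * k′)
          ≡⟨ cong (λ q → q * (s * k′)) (*-distribʳ-+ d (a₁ * v₁) (a₀ * v₀)) ⟩
        (a₁ * v₁ * d + a₀ * v₀ * d) * (s * k′)
          ≡⟨ cong₂ (λ x y → (x + y) * (s * k′)) (*-assoc a₁ v₁ d) (*-assoc a₀ v₀ d) ⟩
        (a₁ * (v₁ * d) + a₀ * (v₀ * d)) * (s * k′)
          ≡⟨ distrib a₁ a₀ (v₁ * d) (v₀ * d) s k′ ⟩
        a₁ * (s * (v₁ * d * k′)) + a₀ * (s * (v₀ * d * k′)) ∎
        where
        v₁ = W (suc j) (suc i) (+ ℓ)
        v₀ = W (suc j) (suc i) (+ suc ℓ)
        d = fromℕ (c σ (suc i ℕ.+ j))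
        k′ = fromℕ (K j (suc i))

  total-boundary : ∀ p i ℓ → ¬ (0 < ℓ × ℓ < size σ i) → total (suc p) i (+ ℓ) ≡ 0ℚ
  total-boundary p i ℓ out = begin
    W (suc p) i (+ ℓ) * k + ∑ (upTo (suc p)) (switching i (+ ℓ))
      ≡⟨ cong₂ _+_ (trans (cong (λ q → q * k) (W-boundary p i ℓ out)) (*-zeroˡ k))
           (trans (∑-cong (upTo (suc p)) no-switching) (∑-zero (upTo (suc p)))) ⟩
    0ℚ ∎
    where
    k = fromℕ (K (suc p) i)
    no-switching : ∀ j → switching i (+ ℓ) j ≡ 0ℚ
    no-switching j = trans (cong (λ q → q * d * k′) (W-boundary j i ℓ out))
      (trans (*-assoc 0ℚ d k′) (*-zeroˡ (d * k′)))
      where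
      d = fromℕ (c σ (i ℕ.+ j))
      k′ = fromℕ (K j i)

  module _ (J⊆ : ∀ i → J σ i ⊆ upFrom i) (i∉J : ∀ i → i ∉ J σ i) where

    -- `f` lists consecutive rows, counted from 0 and starting at i, while levels count from 1. The
    -- bound on ℓ is inherited: a call of cardinality ℓ + 1 that does not return has ℓ + 1 < N, so
    -- both possible cardinalities of a child fit into the N - 1 points of the next level.
    expected≡total : ∀ p (f : Fin p → Fin n) i → (∀ t → toℕ (f t) ≡ i ℕ.+ toℕ t) →
      ∀ ℓ → ℓ ≤ n ∸ i → expected σ (List.tabulate f) ℓ ≡ total p (suc i) (+ ℓ)
    expected≡total zero    f i f≡ ℓ ℓ≤ = sym (total-zero (suc i) ℓ)
    -- Replacing i by the value of `f zero` makes the level of the goal literally `label x`, the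
    -- form in which `expected` computes.
    expected≡total (suc p) f i f≡ = subst (λ i → ∀ ℓ → ℓ ≤ n ∸ i → expected σ (x ∷ is) ℓ ≡ total (suc p) (suc i) (+ ℓ))
      (trans (f≡ zero) (ℕ.+-identityʳ i)) by-cases
      where
      x = f zero
      is = List.tabulate (f ∘ suc)
      c′ = ∣ J σ x ∣

      ih : ∀ ℓ → ℓ ≤ n ∸ label x → expected σ is ℓ ≡ total p (suc (label x)) (+ ℓ)
      ih = expected≡total p (f ∘ suc) (label x) λ t → begin
        toℕ (f (suc t))        ≡⟨ f≡ (suc t) ⟩
        i ℕ.+ suc (toℕ t)      ≡⟨ ℕ.+-suc i (toℕ t) ⟩
        suc i ℕ.+ toℕ t        ≡⟨ cong (λ j → suc j ℕ.+ toℕ t) (trans (f≡ zero) (ℕ.+-identityʳ i)) ⟨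
        label x ℕ.+ toℕ t      ∎

      combine : ℕ → ℕ → ℚ → ℚ → ℚ
      combine ℓ k u v = α σ true (label x) (+ suc ℓ) * (fromℕ (suc k) * u + fromℕ k * fromℕ ℓ)
        + α σ false (label x) (+ suc ℓ) * (fromℕ (suc k) * v + fromℕ k * fromℕ (suc ℓ))

      inner : ∀ ℓ → suc ℓ < n ∸ toℕ x → combine ℓ c′ (expected σ is ℓ) (expected σ is (suc ℓ)) ≡ total (suc p) (label x) (+ suc ℓ)
      inner ℓ ℓ<N = begin
        combine ℓ c′ (expected σ is ℓ) (expected σ is (suc ℓ))
          ≡⟨ cong₂ (combine ℓ c′) (ih ℓ (ℕ.<⇒≤ ℓ<N-1)) (ih (suc ℓ) ℓ<N-1) ⟩
        combine ℓ c′ (total p (suc (label x)) (+ ℓ)) (total p (suc (label x)) (+ suc ℓ))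
          ≡⟨ cong (λ k → combine ℓ k (total p (suc (label x)) (+ ℓ)) (total p (suc (label x)) (+ suc ℓ))) (c-label σ x) ⟨
        combine ℓ (c σ (label x)) (total p (suc (label x)) (+ ℓ)) (total p (suc (label x)) (+ suc ℓ))
          ≡⟨ total-suc p (label x) ℓ ⟨
        total (suc p) (label x) (+ suc ℓ) ∎
        where
        ℓ<N-1 : suc ℓ ≤ n ∸ label x
        ℓ<N-1 = subst (λ m → suc ℓ ≤ m) (ℕ.pred[m∸n]≡m∸[1+n] n (toℕ x)) (ℕ.suc[m]≤n⇒m≤pred[n] ℓ<N)

      if-boundary : ∀ ℓ b → (suc ℓ ℕ.≡ᵇ (n ∸ toℕ x)) ≡ b → suc ℓ ≤ n ∸ toℕ x → ∀ {q} →
        (suc ℓ < n ∸ toℕ x → q ≡ total (suc p) (label x) (+ suc ℓ)) →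
        (if b then 0ℚ else q) ≡ total (suc p) (label x) (+ suc ℓ)
      if-boundary ℓ true eq _ _ = sym (total-boundary p (label x) (suc ℓ) λ (_ , ℓ<N) →
        ℕ.<⇒≢ ℓ<N (ℕ.≡ᵇ⇒≡ (suc ℓ) (n ∸ toℕ x) (subst T (sym eq) _)))
      if-boundary ℓ false eq ℓ≤N inner = inner (ℕ.≤∧≢⇒< ℓ≤N (λ ℓ≡N → subst T eq (ℕ.≡⇒≡ᵇ (suc ℓ) (n ∸ toℕ x) ℓ≡N)))

      by-cases : ∀ ℓ → ℓ ≤ n ∸ toℕ x → expected σ (x ∷ is) ℓ ≡ total (suc p) (label x) (+ ℓ)
      by-cases zero    _   = sym (total-boundary p (label x) 0 λ ())
      by-cases (suc ℓ) ℓ≤N = if-boundary ℓ _ refl ℓ≤N λ ℓ<N →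
        trans (average-calls σ x (J⊆ x) (i∉J x) (expected σ is) ℓ<N) (inner ℓ ℓ<N)

-- The order as a product over the rows, and the closed formula

module _ {G : Pred (Permutation′ n) ℓ₂} (isSubgroup : IsSubgroup G) {σ : Table n} (isSwitchTable : IsSwitchTable G σ) where

  -- Induction on the number p of rows left, starting from the trivial stabiliser at r. As r ≤ n, an
  -- index i with rows left is a point of [n].
  order-stabiliser : ∀ p i → i ℕ.+ p ≡ r σ → HasOrder (Stabiliser G i) (K σ p (suc i))
  order-stabiliser zero    i i≡r = subst (λ j → HasOrder (Stabiliser G j) 1)
    (trans (sym i≡r) (ℕ.+-identityʳ i)) (order-r isSubgroup isSwitchTable)
  order-stabiliser (suc p) i i+p≡r = subst (λ j → HasOrder (Stabiliser G j) (suc (c σ (suc j)) ℕ.* K σ p (suc (suc j))))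
    (Fin.toℕ-fromℕ< i<n)
    (subst (λ m → HasOrder (Stabiliser G (toℕ x)) (suc m ℕ.* K σ p (suc (label x)))) (sym (c-label σ x))
      (order-step isSubgroup isSwitchTable x
        (order-stabiliser p (label x)
          (trans (cong (λ j → suc j ℕ.+ p) (Fin.toℕ-fromℕ< i<n)) (trans (sym (ℕ.+-suc i p)) i+p≡r)))))
    where
    i<n : i < n
    i<n = ℕ.≤-trans (subst (λ m → i < m) i+p≡r (ℕ.m<m+n i ℕ.z<s)) (r≤n σ)
    x = Fin.fromℕ< i<n

  -- `Stabiliser G 0` imposes nothing beyond membership in `G`, so each of the two contains the
  -- other.
  order≡K : ∀ {k} → HasOrder G k → k ≡ K σ (r σ) 1
  order≡K order = ℕ.≤-antisym
    (order-mono (λ π∈G → π∈G , λ _ ()) order (order-stabiliser (r σ) 0 refl))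
    (order-mono proj₁ (order-stabiliser (r σ) 0 refl) order)

-- The product over all rows splits into the rows before, the row in question and the rows after.
-- The last part cancels against κ, and the fraction c / (c + 1) turns the middle factor c + 1 into
-- c.
coefficient : ∀ (σ : Table n) {j} → j < r σ →
  (c σ (suc j) ÷ suc (c σ (suc j))) * (K σ (r σ) 1 ÷ κ σ (suc (suc j))) ≡ fromℕ (c σ (suc j)) * fromℕ (K σ j 1)
coefficient σ {j} j<r = begin
  (c′ ÷ suc c′) * (K σ (r σ) 1 ÷ κ σ (suc (suc j)))
    ≡⟨ cong₂ (λ x y → (c′ ÷ suc c′) * (x ÷ y)) K-split (κ≡K σ (suc (suc j))) ⟩
  (c′ ÷ suc c′) * ((K σ j 1 ℕ.* suc c′ ℕ.* tail) ÷ tail)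
    ≡⟨ cong (λ x → (c′ ÷ suc c′) * x) (÷-unique (K σ j 1 ℕ.* suc c′ ℕ.* tail) tail {{K≢0 σ (r σ ∸ suc j) (suc (suc j))}} (sym (fromℕ-homo-* (K σ j 1 ℕ.* suc c′) tail))) ⟩
  (c′ ÷ suc c′) * fromℕ (K σ j 1 ℕ.* suc c′)
    ≡⟨ cong (λ x → (c′ ÷ suc c′) * x) (fromℕ-homo-* (K σ j 1) (suc c′)) ⟩
  (c′ ÷ suc c′) * (fromℕ (K σ j 1) * fromℕ (suc c′))
    ≡⟨ solve 3 (λ x y z → x :* (y :* z) := x :* z :* y) refl (c′ ÷ suc c′) (fromℕ (K σ j 1)) (fromℕ (suc c′)) ⟩
  (c′ ÷ suc c′) * fromℕ (suc c′) * fromℕ (K σ j 1)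
    ≡⟨ cong (λ x → x * fromℕ (K σ j 1)) (÷-*-cancel c′ (suc c′)) ⟩
  fromℕ c′ * fromℕ (K σ j 1) ∎
  where
  c′ = c σ (suc j)
  tail = K σ (r σ ∸ suc j) (suc (suc j))
  K-split : K σ (r σ) 1 ≡ K σ j 1 ℕ.* suc c′ ℕ.* tail
  K-split = begin
    K σ (r σ) 1                              ≡⟨ cong (λ m → K σ m 1) (ℕ.m+[n∸m]≡n j<r) ⟨
    K σ (suc j ℕ.+ (r σ ∸ suc j)) 1          ≡⟨ cong (λ m → K σ m 1) (ℕ.+-suc j (r σ ∸ suc j)) ⟨
    K σ (j ℕ.+ suc (r σ ∸ suc j)) 1          ≡⟨ K-+ σ j (suc (r σ ∸ suc j)) 1 ⟩
    K σ j 1 ℕ.* (suc c′ ℕ.* tail)            ≡⟨ ℕ.*-assoc (K σ j 1) (suc c′) tail ⟨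
    K σ j 1 ℕ.* suc c′ ℕ.* tail              ∎

take-tabulate : ∀ {m n} (m≤n : m ≤ n) (f : Fin n → A) →
                take m (List.tabulate f) ≡ List.tabulate (λ t → f (Fin.inject≤ t m≤n))
take-tabulate z≤n       f = refl
take-tabulate (s≤s m≤n) f = cong (λ xs → f zero ∷ xs) (take-tabulate m≤n (f ∘ suc))

theorem3 : ∀ {g} (n m k : ℕ) → 1 ≤ m → m < n →
    (G : Pred (Permutation′ n) g) → IsSubgroup G → HasOrder G k →
    (σ : Table n) → IsSwitchTable G σ →
    E-mst σ m
    ≡ (∑[ b ∈ subsets (r σ) ] (w σ 1 (+ m) b * ν σ (+ m) b)) * fromℕ k
    + (∑[ j ∈ range 1 (r σ) ]
    ((∑[ b ∈ subsets j ] (w σ 1 (+ m) b * ν σ (+ m) b))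
    * (c σ j ÷ suc (c σ j))
    * (k ÷ κ σ (suc j))))
theorem3 n m k _ m<n G isSubgroup order σ isSwitchTable = begin
  expected σ (take (r σ) (allFin n)) m
    ≡⟨ cong (λ is → expected σ is m) (take-tabulate (r≤n σ) id) ⟩
  expected σ (List.tabulate (λ t → Fin.inject≤ t (r≤n σ))) m
    ≡⟨ expected≡total σ (J⊆upFrom isSubgroup isSwitchTable) (i∉Ji isSubgroup isSwitchTable)
         (r σ) _ 0 (λ t → Fin.toℕ-inject≤ t (r≤n σ)) m (ℕ.<⇒≤ m<n) ⟩
  total σ (r σ) 1 (+ m)
    ≡⟨ +-congˡ (W σ (r σ) 1 (+ m) * fromℕ (K σ (r σ) 1)) (begin
         ∑ (upTo (r σ)) (switching σ 1 (+ m))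
           -- The bound j < r used in cancelling κ comes from membership in `upTo`, whose rows are
           -- counted from 0; the next two steps shift to the range from 1 to r.
           ≡⟨ ∑-cong-All (All.applyUpTo⁺₁ id (r σ) regroup) ⟩
         ∑ (upTo (r σ)) (summand (K σ (r σ) 1) ∘ suc)
           ≡⟨ ∑-map suc (upTo (r σ)) (summand (K σ (r σ) 1)) ⟨
         ∑ (map suc (upTo (r σ))) (summand (K σ (r σ) 1))
           ≡⟨ cong (λ js → ∑ js (summand (K σ (r σ) 1))) (List.map-upTo suc (r σ)) ⟩
         ∑ (range 1 (r σ)) (summand (K σ (r σ) 1)) ∎) ⟩
  W σ (r σ) 1 (+ m) * fromℕ (K σ (r σ) 1) + ∑ (range 1 (r σ)) (summand (K σ (r σ) 1))
    ≡⟨ cong (λ k → W σ (r σ) 1 (+ m) * fromℕ k + ∑ (range 1 (r σ)) (summand k))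
         (order≡K isSubgroup isSwitchTable order) ⟨
  W σ (r σ) 1 (+ m) * fromℕ k + ∑ (range 1 (r σ)) (summand k) ∎
  where
  summand : ℕ → ℕ → ℚ
  summand k j = W σ j 1 (+ m) * (c σ j ÷ suc (c σ j)) * (k ÷ κ σ (suc j))
  regroup : ∀ {j} → j < r σ → switching σ 1 (+ m) j ≡ summand (K σ (r σ) 1) (suc j)
  regroup {j} j<r = begin
    W σ (suc j) 1 (+ m) * fromℕ (c σ (suc j)) * fromℕ (K σ j 1)
      ≡⟨ *-assoc (W σ (suc j) 1 (+ m)) (fromℕ (c σ (suc j))) (fromℕ (K σ j 1)) ⟩
    W σ (suc j) 1 (+ m) * (fromℕ (c σ (suc j)) * fromℕ (K σ j 1))
      ≡⟨ cong (λ x → W σ (suc j) 1 (+ m) * x) (coefficient σ j<r) ⟨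
    W σ (suc j) 1 (+ m) * ((c σ (suc j) ÷ suc (c σ (suc j))) * (K σ (r σ) 1 ÷ κ σ (suc (suc j))))
      ≡⟨ *-assoc (W σ (suc j) 1 (+ m)) (c σ (suc j) ÷ suc (c σ (suc j))) (K σ (r σ) 1 ÷ κ σ (suc (suc j))) ⟨
    summand (K σ (r σ) 1) (suc j) ∎
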